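{- $\epsilon_{\mathrm{LINE}}\leq \dfrac{\log 3}{\log 7}$.
   Context: Let $\mathbf{v}\in\mathbb{R}^3$ be a nonzero direction and let $\mathcal{L}$ be a finite set of pairwise skew lines in $\mathbb{R}^3$, in general position with respect to $\mathbf{v}$: no line is parallel to $\mathbf{v}$, and the projections of any two distinct lines of $\mathcal{L}$ along $\mathbf{v}$ onto the plane $\mathbf{v}^{\perp}$ are not parallel (so they cross in exactly one point). For distinct $\ell_1,\ell_2\in\mathcal{L}$, let $p\in\mathbf{v}^\perp$ be the crossing point of their projections; there are unique reals $z_1,z_2$ with $p+z_i\mathbf{v}\in\ell_i$, and $z_1\ne z_2$ since the lines are skew. Say that $\ell_1$ crosses over $\ell_2$ if $z_1>z_2$. This relation is a tournament on $\mathcal{L}$. A subset of $\mathcal{L}$ is called stacked (with respect to $\mathbf{v}$) if it is linearly ordered by the crossing-over relation, i.e. it induces a transitive subtournament. $\epsilon_{\mathrm{LINE}}$ denotes the best exponent for stacked subsets: the supremum of all real $\epsilon\ge 0$ for which there is a constant $c>0$ such that, for every $n\geq 1$, every $\mathbf{v}$ and every such configuration $\mathcal{L}$ of $n$ lines, $\mathcal{L}$ contains a stacked subset of size at least $c\,n^{\epsilon}$. -}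

module Defs where

open import Data.Nat.Base as ℕ using (ℕ; zero; suc)
import Data.Nat.Properties as ℕ
open import Data.Integer.Base as ℤ using (+_)
import Data.Integer.Properties as ℤ
open import Data.Rational.Base as ℚ using (ℚ; 0ℚ; 1ℚ; ½)
import Data.Rational.Properties as ℚ
import Data.Rational.Unnormalised.Base as ℚᵘ
import Data.Rational.Unnormalised.Properties as ℚᵘ
open import Data.Fin.Base using (Fin)
open import Data.Fin.Subset as Subset using (Subset; _∈_)
open import Data.Product using (∃; ∃₂; _×_; _,_; proj₁; proj₂)
open import Data.Sum using (_⊎_; inj₁; inj₂)
open import Function.Base using (_on_)
open import Level using (0ℓ)
open import Relation.Binary.PropositionalEquality
  using (_≡_; _≢_; refl; sym; trans; cong; cong₂; subst; subst₂)
open import Relation.Binary.Structures using (IsStrictTotalOrder)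
open import Relation.Nullary using (¬_; yes; no; contradiction)
open import Relation.Nullary.Decidable using (dec⇒maybe)
open import Tactic.RingSolver using (solve-∀)
open import Tactic.RingSolver.Core.AlmostCommutativeRing
  using (AlmostCommutativeRing; fromCommutativeRing)

fromℕ : ℕ → ℚ
fromℕ n = + n ℚ./ 1

1/suc : ℕ → ℚ
1/suc k = + 1 ℚ./ suc k

Σ< : ℕ → (ℕ → ℚ) → ℚ
Σ< zero    f = 0ℚ
Σ< (suc n) f = Σ< n f ℚ.+ f n

-- The reciprocal, extended by 0⁻¹ = 0.
inv : ℚ → ℚ
inv q with q ℚ.≟ 0ℚ
... | yes _ = 0ℚ
... | no q≢0 = (ℚ.1/ q) {{ℚ.≢-nonZero q≢0}}

-- expTerm x k = xᵏ/k!
expTerm : ℚ → ℕ → ℚ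
expTerm x zero    = 1ℚ
expTerm x (suc k) = expTerm x k ℚ.* x ℚ.* 1/suc k

expSum : ℚ → ℕ → ℚ
expSum x n = Σ< (suc n) (expTerm x)

-- H_n = 1 + 1/2 + … + 1/n
harmonic : ℕ → ℚ
harmonic n = Σ< n 1/suc

-- With N = n + 1 this is H_{aN} - H_N = Σ_{N < i ≤ aN} 1/i, the Riemann sum
-- of mesh 1/N, with right endpoints, of ∫₁ᵃ dx/x.
logSum : ℕ → ℕ → ℚ
logSum a n = harmonic (a ℕ.* suc n) ℚ.- harmonic (suc n)

Cauchy : (ℕ → ℚ) → Set
Cauchy f = ∀ e → 0ℚ ℚ.< e →
  ∃ λ N → ∀ m n → N ℕ.≤ m → N ℕ.≤ n → ℚ.∣ f m ℚ.- f n ∣ ℚ.< e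

module CauchyLemmas where
  open import Data.Rational.Base
    using (mkℚ; _+_; _*_; _-_; -_; ∣_∣; _≤_; _<_; *<*; 1/_; positive; nonNegative; ≢-nonZero)

  ℚ-ring : AlmostCommutativeRing 0ℓ 0ℓ
  ℚ-ring = fromCommutativeRing ℚ.+-*-commutativeRing (λ q → dec⇒maybe (0ℚ ℚ.≟ q))

  ring3′ : ∀ q e → e ≡ - q + (q + e)
  ring3′ = solve-∀ ℚ-ring

  ring23 : ∀ a b s → a - b ≡ a + s - (b + s)
  ring23 = solve-∀ ℚ-ring

  ring24 : ∀ a b s → a - (b + s) + s ≡ a - b
  ring24 = solve-∀ ℚ-ring

  ring1 : ∀ p q → - (p - q) ≡ q - p
  ring1 = solve-∀ ℚ-ring

  ring2 : ∀ K d → K * (d + d) ≡ (K + K) * d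
  ring2 = solve-∀ ℚ-ring

  ring3 : ∀ a b → a + b - a ≡ b
  ring3 = solve-∀ ℚ-ring

  ring4 : ∀ a b → a ≡ b + (a - b)
  ring4 = solve-∀ ℚ-ring

  ring5 : ∀ a b c d → a + b - (c + d) ≡ (a - c) + (b - d)
  ring5 = solve-∀ ℚ-ring

  ring6 : ∀ a b → b - a ≡ - a - - b
  ring6 = solve-∀ ℚ-ring

  ring7 : ∀ a b c d → a * b - c * d ≡ (a - c) * d + a * (b - d)
  ring7 = solve-∀ ℚ-ring

  ring8 : ∀ a b K → a * K + K * b ≡ K * (a + b)
  ring8 = solve-∀ ℚ-ring

  ring9 : ∀ a b a' b' → a' * b' * (b - a) ≡ a' * (b * b') - b' * (a * a')
  ring9 = solve-∀ ℚ-ring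

  ring10 : ∀ a b c → c * (a * b) ≡ a * (c * b)
  ring10 = solve-∀ ℚ-ring

  ring11 : ∀ t m r → t * m * r + t * m * r ≡ (t + t) * (m * r)
  ring11 = solve-∀ ℚ-ring

  ring12 : ∀ t m r → t * m * r + t * m * r ≡ t * ((m + m) * r)
  ring12 = solve-∀ ℚ-ring

  ring13 : ∀ a b → 1ℚ * a * 1ℚ - 1ℚ * b * 1ℚ ≡ a - b
  ring13 = solve-∀ ℚ-ring

  ring14 : ∀ A a r B b → A * a * r - B * b * r ≡ ((A - B) * a + B * (a - b)) * r
  ring14 = solve-∀ ℚ-ring

  ring15 : ∀ t D M t' → t * D * M + t' * D ≡ (t * M + t') * D
  ring15 = solve-∀ ℚ-ring

  ring16 : ∀ n t → n * t + t ≡ (n + 1ℚ) * t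
  ring16 = solve-∀ ℚ-ring

  ring17 : ∀ n t D r → n * t * D * r ≡ (n * r) * (t * D)
  ring17 = solve-∀ ℚ-ring

  ring18 : ∀ x y z → x + y - z ≡ (x - z) + y
  ring18 = solve-∀ ℚ-ring

  ring19 : ∀ x y z → (x - z) + y ≡ x + y - z
  ring19 = solve-∀ ℚ-ring

  ring20 : ∀ x y z → x - z ≡ (x - y) + (y - z)
  ring20 = solve-∀ ℚ-ring

  ring22 : ∀ C D E → C * D + E + (C * E + D) ≡ (C + 1ℚ) * (D + E)
  ring22 = solve-∀ ℚ-ring

  *-mono-≤ : ∀ {p q r s} → 0ℚ ≤ p → 0ℚ ≤ s → p ≤ q → r ≤ s → p * r ≤ q * s
  *-mono-≤ {p} {q} {r} {s} 0≤p 0≤s p≤q r≤s = ℚ.≤-trans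
    (ℚ.*-monoˡ-≤-nonNeg p {{nonNegative 0≤p}} r≤s)
    (ℚ.*-monoʳ-≤-nonNeg s {{nonNegative 0≤s}} p≤q)

  *-nonNeg : ∀ {p q} → 0ℚ ≤ p → 0ℚ ≤ q → 0ℚ ≤ p * q
  *-nonNeg {p} {q} 0≤p 0≤q =
    ℚ.nonNegative⁻¹ _ {{ℚ.nonNeg*nonNeg⇒nonNeg p {{nonNegative 0≤p}} q {{nonNegative 0≤q}}}}

  *-pos : ∀ {p q} → 0ℚ < p → 0ℚ < q → 0ℚ < p * q
  *-pos {p} {q} 0<p 0<q =
    ℚ.positive⁻¹ _ {{ℚ.pos*pos⇒pos p {{positive 0<p}} q {{positive 0<q}}}}

  +-pos : ∀ {p q} → 0ℚ < p → 0ℚ < q → 0ℚ < p + q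
  +-pos 0<p 0<q = ℚ.+-mono-< 0<p 0<q

  quotient : ∀ K e → 0ℚ < K → 0ℚ < e → ∃ λ d → 0ℚ < d × K * d ≡ e
  quotient K e 0<K 0<e = 1/K * e , *-pos 0<1/K 0<e ,
    trans (sym (ℚ.*-assoc K 1/K e))
      (trans (cong (_* e) (ℚ.*-inverseʳ K {{nz}})) (ℚ.*-identityˡ e))
    where
      instance pK = positive 0<K
      nz = ℚ.pos⇒nonZero K
      1/K = (1/ K) {{nz}}
      0<1/K : 0ℚ < 1/K
      0<1/K = ℚ.positive⁻¹ _ {{ℚ.1/pos⇒pos K}}

  0<1/suc : ∀ k → 0ℚ < 1/suc k
  0<1/suc k = ℚ.positive⁻¹ _ {{ℚ.normalize-pos 1 (suc k)}}

  1/suc-antimono : ∀ {m n} → m ℕ.≤ n → 1/suc n ≤ 1/suc m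
  1/suc-antimono {m} {n} m≤n = ℚ.toℚᵘ-cancel-≤
    (ℚᵘ.≤-respˡ-≃ (ℚᵘ.≃-sym (ℚ.toℚᵘ-fromℚᵘ (ℚᵘ.mkℚᵘ (+ 1) n)))
    (ℚᵘ.≤-respʳ-≃ (ℚᵘ.≃-sym (ℚ.toℚᵘ-fromℚᵘ (ℚᵘ.mkℚᵘ (+ 1) m)))
    (ℚᵘ.*≤* (ℤ.+≤+ (ℕ.+-monoˡ-≤ 0 (ℕ.s≤s m≤n))))))

  1/suc-strict : ∀ n → 1/suc (suc n) < 1/suc n
  1/suc-strict n = ℚ.toℚᵘ-cancel-<
    (ℚᵘ.<-respˡ-≃ (ℚᵘ.≃-sym (ℚ.toℚᵘ-fromℚᵘ (ℚᵘ.mkℚᵘ (+ 1) (suc n))))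
    (ℚᵘ.<-respʳ-≃ (ℚᵘ.≃-sym (ℚ.toℚᵘ-fromℚᵘ (ℚᵘ.mkℚᵘ (+ 1) n)))
    (ℚᵘ.*<* (ℤ.+<+ (ℕ.+-monoˡ-< 0 (ℕ.n<1+n (suc n)))))))

  1/suc-below : ∀ e → 0ℚ < e → ∃ λ k → 1/suc k ≤ e
  1/suc-below e@(mkℚ (ℤ.+[1+ n ]) d _) 0<e = d , ℚ.toℚᵘ-cancel-≤
    (ℚᵘ.≤-respˡ-≃ (ℚᵘ.≃-sym (ℚ.toℚᵘ-fromℚᵘ (ℚᵘ.mkℚᵘ (+ 1) d)))
    (ℚᵘ.*≤* (ℤ.+≤+ (ℕ.*-monoˡ-≤ (suc d) (ℕ.s≤s (ℕ.z≤n {n}))))))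
  1/suc-below (mkℚ (+ 0) d _) (*<* (ℤ.+<+ ()))
  1/suc-below (mkℚ (ℤ.-[1+ n ]) d _) (*<* ())

  archimedean : ∀ e → 0ℚ < e → ∃ λ N → ∀ n → N ℕ.≤ n → 1/suc n < e
  archimedean e 0<e = go (1/suc-below e 0<e)
    where
    go : (∃ λ k → 1/suc k ≤ e) → ∃ λ N → ∀ n → N ℕ.≤ n → 1/suc n < e
    go (k , h) = suc k , λ n k<n →
      ℚ.≤-<-trans (1/suc-antimono k<n) (ℚ.<-≤-trans (1/suc-strict k) h)

  ≤∣∣ : ∀ p → p ≤ ∣ p ∣
  ≤∣∣ p with ℚ.≤-total 0ℚ p
  ... | inj₁ 0≤p = ℚ.≤-reflexive (sym (ℚ.0≤p⇒∣p∣≡p 0≤p))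
  ... | inj₂ p≤0 = ℚ.≤-trans p≤0 (ℚ.0≤∣p∣ p)

  ∣-∣-sym : ∀ p q → ∣ p - q ∣ ≡ ∣ q - p ∣
  ∣-∣-sym p q = trans (sym (ℚ.∣-p∣≡∣p∣ (p - q)))
    (cong ∣_∣ (ring1 p q))

  p≤q⇒0≤q-p : ∀ {p q} → p ≤ q → 0ℚ ≤ q - p
  p≤q⇒0≤q-p {p} {q} p≤q = subst (_≤ q - p) (ℚ.+-inverseʳ p) (ℚ.+-monoˡ-≤ (- p) p≤q)

  cauchy-by : ∀ {f g h : ℕ → ℚ} → Cauchy f → Cauchy g → ∀ K → 0ℚ < K → ∀ N₀ →
    (∀ m n → N₀ ℕ.≤ m → N₀ ℕ.≤ n →
       ∣ h m - h n ∣ ≤ K * (∣ f m - f n ∣ + ∣ g m - g n ∣)) →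
    Cauchy h
  cauchy-by {f} {g} {h} cf cg K 0<K N₀ est e 0<e = go (quotient (K + K) e (+-pos 0<K 0<K) 0<e)
    where
    open ℚ.≤-Reasoning
    go : (∃ λ d → 0ℚ < d × (K + K) * d ≡ e) →
      ∃ λ N → ∀ m n → N ℕ.≤ m → N ℕ.≤ n → ∣ h m - h n ∣ < e
    go (d , 0<d , eq) = N₀ ℕ.+ (N₁ ℕ.+ N₂) , λ m n pm pn → begin-strict
      ∣ h m - h n ∣                         ≤⟨ est m n (≥₀ pm) (≥₀ pn) ⟩
      K * (∣ f m - f n ∣ + ∣ g m - g n ∣)   <⟨ ℚ.*-monoʳ-<-pos K {{positive 0<K}}
                                                 (ℚ.+-mono-< (proj₂ (cf d 0<d) m n (≥₁ pm) (≥₁ pn))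
                                                             (proj₂ (cg d 0<d) m n (≥₂ pm) (≥₂ pn))) ⟩
      K * (d + d)                           ≡⟨ ring2 K d ⟩
      (K + K) * d                           ≡⟨ eq ⟩
      e                                     ∎
      where
      N₁ = proj₁ (cf d 0<d)
      N₂ = proj₁ (cg d 0<d)
      ≥₀ : ∀ {m} → N₀ ℕ.+ (N₁ ℕ.+ N₂) ℕ.≤ m → N₀ ℕ.≤ m
      ≥₀ = ℕ.m+n≤o⇒m≤o N₀
      ≥₁ : ∀ {m} → N₀ ℕ.+ (N₁ ℕ.+ N₂) ℕ.≤ m → N₁ ℕ.≤ m
      ≥₁ p = ℕ.m+n≤o⇒m≤o N₁ (ℕ.m+n≤o⇒n≤o N₀ p)
      ≥₂ : ∀ {m} → N₀ ℕ.+ (N₁ ℕ.+ N₂) ℕ.≤ m → N₂ ℕ.≤ m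
      ≥₂ p = ℕ.m+n≤o⇒n≤o N₁ (ℕ.m+n≤o⇒n≤o N₀ p)

  -- h increases and h + r decreases from N₀ on, where r tends to zero.
  squeeze : ∀ {h} (r : ℕ → ℚ) K → 0ℚ < K → ∀ N₀ →
    (∀ n → N₀ ℕ.≤ n → h n ≤ h (suc n)) →
    (∀ n → N₀ ℕ.≤ n → h (suc n) + r (suc n) ≤ h n + r n) →
    (∀ n → N₀ ℕ.≤ n → 0ℚ ≤ r n) →
    (∀ n → N₀ ℕ.≤ n → r n ≤ K * 1/suc n) →
    Cauchy h
  squeeze {h} r K 0<K N₀ incr decr r≥0 r≤ e 0<e = go (quotient K e 0<K 0<e)
    where
    open ℚ.≤-Reasoning
    up : ∀ {m n} → N₀ ℕ.≤ m → m ℕ.≤′ n → h m ≤ h n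
    up p ℕ.≤′-refl = ℚ.≤-refl
    up p (ℕ.≤′-step q) = ℚ.≤-trans (up p q) (incr _ (ℕ.≤-trans p (ℕ.≤′⇒≤ q)))
    down : ∀ {m n} → N₀ ℕ.≤ m → m ℕ.≤′ n → h n + r n ≤ h m + r m
    down p ℕ.≤′-refl = ℚ.≤-refl
    down p (ℕ.≤′-step q) = ℚ.≤-trans (decr _ (ℕ.≤-trans p (ℕ.≤′⇒≤ q))) (down p q)
    gap : ∀ m n → N₀ ℕ.≤ m → m ℕ.≤ n → ∣ h n - h m ∣ ≤ K * 1/suc m
    gap m n p m≤n = begin
      ∣ h n - h m ∣        ≡⟨ ℚ.0≤p⇒∣p∣≡p (p≤q⇒0≤q-p (up p (ℕ.≤⇒≤′ m≤n))) ⟩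
      h n - h m            ≡⟨ cong (_- h m) (ℚ.+-identityʳ (h n)) ⟨
      h n + 0ℚ - h m       ≤⟨ ℚ.+-monoˡ-≤ (- h m) (ℚ.+-monoʳ-≤ (h n) (r≥0 n (ℕ.≤-trans p m≤n))) ⟩
      h n + r n - h m      ≤⟨ ℚ.+-monoˡ-≤ (- h m) (down p (ℕ.≤⇒≤′ m≤n)) ⟩
      h m + r m - h m      ≡⟨ ring3 (h m) (r m) ⟩
      r m                  ≤⟨ r≤ m p ⟩
      K * 1/suc m          ∎
    go : (∃ λ d → 0ℚ < d × K * d ≡ e) →
      ∃ λ N → ∀ m n → N ℕ.≤ m → N ℕ.≤ n → ∣ h m - h n ∣ < e
    go (d , 0<d , eq) = N₀ ℕ.+ N₁ , bound
      where
      N₁ = proj₁ (archimedean d 0<d)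
      half : ∀ m n → N₀ ℕ.+ N₁ ℕ.≤ m → m ℕ.≤ n → ∣ h n - h m ∣ < e
      half m n p m≤n = ℚ.≤-<-trans (gap m n (ℕ.m+n≤o⇒m≤o N₀ p) m≤n)
        (subst (K * 1/suc m <_) eq (ℚ.*-monoʳ-<-pos K {{positive 0<K}}
          (proj₂ (archimedean d 0<d) m (ℕ.m+n≤o⇒n≤o N₀ p))))
      bound : ∀ m n → N₀ ℕ.+ N₁ ℕ.≤ m → N₀ ℕ.+ N₁ ℕ.≤ n → ∣ h m - h n ∣ < e
      bound m n pm pn = choose (ℕ.≤-total m n)
        where
        choose : m ℕ.≤ n ⊎ n ℕ.≤ m → ∣ h m - h n ∣ < e
        choose (inj₁ m≤n) = subst (_< e) (∣-∣-sym (h n) (h m)) (half m n pm m≤n)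
        choose (inj₂ n≤m) = half n m pn n≤m

  Bounded : (ℕ → ℚ) → Set
  Bounded f = ∃ λ B → 0ℚ < B × ∃ λ N → ∀ n → N ℕ.≤ n → ∣ f n ∣ ≤ B

  bounded : ∀ {f} → Cauchy f → Bounded f
  bounded {f} cf =
    ∣ f N ∣ + 1ℚ , ℚ.+-mono-≤-< (ℚ.0≤∣p∣ (f N)) (ℚ.positive⁻¹ 1ℚ) , N , λ n p → begin
      ∣ f n ∣                    ≡⟨ cong ∣_∣ (ring4 (f n) (f N)) ⟩
      ∣ f N + (f n - f N) ∣      ≤⟨ ℚ.∣p+q∣≤∣p∣+∣q∣ (f N) (f n - f N) ⟩
      ∣ f N ∣ + ∣ f n - f N ∣    ≤⟨ ℚ.+-monoʳ-≤ ∣ f N ∣ (ℚ.<⇒≤ (proj₂ (cf 1ℚ (ℚ.positive⁻¹ 1ℚ)) n N p ℕ.≤-refl)) ⟩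
      ∣ f N ∣ + 1ℚ               ∎
    where
    open ℚ.≤-Reasoning
    N = proj₁ (cf 1ℚ (ℚ.positive⁻¹ 1ℚ))

  const-cauchy : ∀ q → Cauchy (λ _ → q)
  const-cauchy q e 0<e = 0 , λ _ _ _ _ →
    subst (_< e) (sym (cong ∣_∣ (ℚ.+-inverseʳ q))) 0<e

  +-cauchy : ∀ {f g} → Cauchy f → Cauchy g → Cauchy (λ n → f n + g n)
  +-cauchy {f} {g} cf cg = cauchy-by {f} {g} {λ n → f n + g n} cf cg 1ℚ (ℚ.positive⁻¹ 1ℚ) 0 λ m n _ _ → begin
      ∣ f m + g m - (f n + g n) ∣         ≡⟨ cong ∣_∣ (ring5
                                               (f m) (g m) (f n) (g n)) ⟩
      ∣ (f m - f n) + (g m - g n) ∣       ≤⟨ ℚ.∣p+q∣≤∣p∣+∣q∣ (f m - f n) (g m - g n) ⟩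
      ∣ f m - f n ∣ + ∣ g m - g n ∣       ≡⟨ ℚ.*-identityˡ _ ⟨
      1ℚ * (∣ f m - f n ∣ + ∣ g m - g n ∣) ∎
    where open ℚ.≤-Reasoning

  neg-cauchy : ∀ {f} → Cauchy f → Cauchy (λ n → - f n)
  neg-cauchy {f} cf e 0<e = proj₁ (cf e 0<e) , λ m n pm pn →
    subst (_< e) (trans (∣-∣-sym (f m) (f n)) (cong ∣_∣ (ring6 (f m) (f n))))
      (proj₂ (cf e 0<e) m n pm pn)

  product-bound : ∀ a b c d K → 0ℚ ≤ K → ∣ a ∣ ≤ K → ∣ d ∣ ≤ K →
    ∣ a * b - c * d ∣ ≤ K * (∣ a - c ∣ + ∣ b - d ∣)
  product-bound a b c d K 0≤K ha hd = begin
    ∣ a * b - c * d ∣                        ≡⟨ cong ∣_∣ (ring7 a b c d) ⟩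
    ∣ (a - c) * d + a * (b - d) ∣            ≤⟨ ℚ.∣p+q∣≤∣p∣+∣q∣ ((a - c) * d) (a * (b - d)) ⟩
    ∣ (a - c) * d ∣ + ∣ a * (b - d) ∣        ≡⟨ cong₂ _+_ (ℚ.∣p*q∣≡∣p∣*∣q∣ (a - c) d) (ℚ.∣p*q∣≡∣p∣*∣q∣ a (b - d)) ⟩
    ∣ a - c ∣ * ∣ d ∣ + ∣ a ∣ * ∣ b - d ∣    ≤⟨ ℚ.+-mono-≤
                                                  (*-mono-≤ (ℚ.0≤∣p∣ (a - c)) 0≤K ℚ.≤-refl hd)
                                                  (*-mono-≤ (ℚ.0≤∣p∣ a) (ℚ.0≤∣p∣ (b - d)) ha ℚ.≤-refl) ⟩
    ∣ a - c ∣ * K + K * ∣ b - d ∣            ≡⟨ ring8 ∣ a - c ∣ ∣ b - d ∣ K ⟩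
    K * (∣ a - c ∣ + ∣ b - d ∣)              ∎
    where open ℚ.≤-Reasoning

  p≤p+q : ∀ p {q} → 0ℚ ≤ q → p ≤ p + q
  p≤p+q p {q} 0≤q = subst (_≤ p + q) (ℚ.+-identityʳ p) (ℚ.+-monoʳ-≤ p 0≤q)

  p≤q+p : ∀ p {q} → 0ℚ ≤ q → p ≤ q + p
  p≤q+p p {q} 0≤q = subst (_≤ q + p) (ℚ.+-identityˡ p) (ℚ.+-monoˡ-≤ p 0≤q)

  *-cauchy : ∀ {f g} → Cauchy f → Cauchy g → Cauchy (λ n → f n * g n)
  *-cauchy {f} {g} cf cg = go (bounded cf) (bounded cg)
    where
    go : Bounded f → Bounded g → Cauchy (λ n → f n * g n)
    go (B , 0<B , N , hf) (C , 0<C , M , hg) =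
      cauchy-by {f} {g} {λ n → f n * g n} cf cg (B + C) (+-pos 0<B 0<C) (N ℕ.+ M) λ m n pm pn →
        product-bound (f m) (g m) (f n) (g n) (B + C) (ℚ.<⇒≤ (+-pos 0<B 0<C))
          (ℚ.≤-trans (hf m (ℕ.m+n≤o⇒m≤o N pm)) (p≤p+q B (ℚ.<⇒≤ 0<C)))
          (ℚ.≤-trans (hg n (ℕ.m+n≤o⇒n≤o N pn)) (p≤q+p C (ℚ.<⇒≤ 0<B)))

  inv-inverse : ∀ q → ¬ q ≡ 0ℚ → q * inv q ≡ 1ℚ
  inv-inverse q q≢0 with q ℚ.≟ 0ℚ
  ... | yes q≡0 = contradiction q≡0 q≢0
  ... | no q≢0′ = ℚ.*-inverseʳ q {{≢-nonZero q≢0′}}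

  inv-difference : ∀ a b a' b' → a * a' ≡ 1ℚ → b * b' ≡ 1ℚ → a' - b' ≡ a' * b' * (b - a)
  inv-difference a b a' b' ea eb = sym (trans (ring9 a b a' b')
    (cong₂ _-_ (trans (cong (a' *_) eb) (ℚ.*-identityʳ a')) (trans (cong (b' *_) ea) (ℚ.*-identityʳ b'))))

  inv-bound : ∀ e d a a' → 0ℚ < e → e * d ≡ 1ℚ → e ≤ ∣ a ∣ → a * a' ≡ 1ℚ → ∣ a' ∣ ≤ d
  inv-bound e d a a' 0<e ed≡1 e≤a aa'≡1 = ℚ.*-cancelˡ-≤-pos e {{positive 0<e}} (begin
    e * ∣ a' ∣       ≤⟨ ℚ.*-monoʳ-≤-nonNeg ∣ a' ∣ {{ℚ.∣-∣-nonNeg a'}} e≤a ⟩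
    ∣ a ∣ * ∣ a' ∣   ≡⟨ ℚ.∣p*q∣≡∣p∣*∣q∣ a a' ⟨
    ∣ a * a' ∣       ≡⟨ cong ∣_∣ aa'≡1 ⟩
    1ℚ               ≡⟨ ed≡1 ⟨
    e * d            ∎)
    where open ℚ.≤-Reasoning

  inv-lipschitz : ∀ a b a' b' d → 0ℚ ≤ d → a * a' ≡ 1ℚ → b * b' ≡ 1ℚ → ∣ a' ∣ ≤ d → ∣ b' ∣ ≤ d →
    ∣ a' - b' ∣ ≤ d * d * (∣ a - b ∣ + ∣ a - b ∣)
  inv-lipschitz a b a' b' d 0≤d ea eb ha hb = begin
    ∣ a' - b' ∣                    ≡⟨ cong ∣_∣ (inv-difference a b a' b' ea eb) ⟩
    ∣ a' * b' * (b - a) ∣          ≡⟨ ℚ.∣p*q∣≡∣p∣*∣q∣ (a' * b') (b - a) ⟩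
    ∣ a' * b' ∣ * ∣ b - a ∣        ≡⟨ cong₂ _*_ (ℚ.∣p*q∣≡∣p∣*∣q∣ a' b') (∣-∣-sym b a) ⟩
    ∣ a' ∣ * ∣ b' ∣ * ∣ a - b ∣    ≤⟨ *-mono-≤ (*-nonNeg (ℚ.0≤∣p∣ a') (ℚ.0≤∣p∣ b'))
                                        (ℚ.+-mono-≤ (ℚ.0≤∣p∣ (a - b)) (ℚ.0≤∣p∣ (a - b)))
                                        (*-mono-≤ (ℚ.0≤∣p∣ a') 0≤d ha hb)
                                        (p≤p+q ∣ a - b ∣ (ℚ.0≤∣p∣ (a - b))) ⟩
    d * d * (∣ a - b ∣ + ∣ a - b ∣) ∎
    where open ℚ.≤-Reasoning

  inv-cauchy : ∀ {f} → Cauchy f → ∀ e → 0ℚ < e → ∀ N → (∀ n → N ℕ.≤ n → e ≤ ∣ f n ∣) →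
               Cauchy (λ n → inv (f n))
  inv-cauchy {f} cf e 0<e N far = go (quotient e 1ℚ 0<e (ℚ.positive⁻¹ 1ℚ))
    where
    inverse : ∀ n → N ℕ.≤ n → f n * inv (f n) ≡ 1ℚ
    inverse n p = inv-inverse (f n) λ eq → ℚ.<⇒≢ (ℚ.<-≤-trans 0<e (far n p)) (sym (cong ∣_∣ eq))
    go : (∃ λ d → 0ℚ < d × e * d ≡ 1ℚ) → Cauchy (λ n → inv (f n))
    go (d , 0<d , ed≡1) = cauchy-by {f} {f} {λ n → inv (f n)} cf cf (d * d) (*-pos 0<d 0<d) N λ m n pm pn →
      inv-lipschitz (f m) (f n) (inv (f m)) (inv (f n)) d (ℚ.<⇒≤ 0<d) (inverse m pm) (inverse n pn)
        (inv-bound e d (f m) (inv (f m)) 0<e ed≡1 (far m pm) (inverse m pm))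
        (inv-bound e d (f n) (inv (f n)) 0<e ed≡1 (far n pn) (inverse n pn))

  fromℕ*1/suc : ∀ k → fromℕ (suc k) * 1/suc k ≡ 1ℚ
  fromℕ*1/suc k = ℚ.toℚᵘ-injective (ℚᵘ.≃-trans (ℚ.toℚᵘ-homo-* (fromℕ (suc k)) (1/suc k))
    (ℚᵘ.≃-trans (ℚᵘ.*-cong (ℚ.toℚᵘ-fromℚᵘ (ℚᵘ.mkℚᵘ (+ suc k) 0)) (ℚ.toℚᵘ-fromℚᵘ (ℚᵘ.mkℚᵘ (+ 1) k)))
      (ℚᵘ.*≡* (cong +_ (lem k)))))
    where
    lem : ∀ k → suc k ℕ.* 1 ℕ.* 1 ≡ suc (k ℕ.+ 0 ℕ.+ 0)
    lem k = trans (ℕ.*-identityʳ (suc k ℕ.* 1)) (trans (ℕ.*-identityʳ (suc k))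
      (cong suc (sym (trans (ℕ.+-identityʳ (k ℕ.+ 0)) (ℕ.+-identityʳ k)))))

  fromℕ-suc : ∀ k → fromℕ (suc k) ≡ fromℕ k + 1ℚ
  fromℕ-suc k = ℚ.toℚᵘ-injective (ℚᵘ.≃-trans (ℚ.toℚᵘ-fromℚᵘ (ℚᵘ.mkℚᵘ (+ suc k) 0))
    (ℚᵘ.≃-trans {j = ℚᵘ.mkℚᵘ (+ k) 0 ℚᵘ.+ ℚᵘ.1ℚᵘ} (ℚᵘ.*≡* (lem k))
    (ℚᵘ.≃-sym (ℚᵘ.≃-trans (ℚ.toℚᵘ-homo-+ (fromℕ k) 1ℚ)
      (ℚᵘ.+-cong (ℚ.toℚᵘ-fromℚᵘ (ℚᵘ.mkℚᵘ (+ k) 0)) (ℚᵘ.≃-refl {ℚᵘ.1ℚᵘ}))))))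
    where
    lem : ∀ k → + suc k ℤ.* + 1 ≡ (+ k ℤ.* + 1 ℤ.+ + 1) ℤ.* + 1
    lem k = trans (ℤ.*-identityʳ (+ suc k)) (sym (trans (ℤ.*-identityʳ (+ k ℤ.* + 1 ℤ.+ + 1))
      (trans (cong (ℤ._+ + 1) (ℤ.*-identityʳ (+ k))) (cong +_ (ℕ.+-comm k 1)))))

  module _ {M : ℚ} (0<M : 0ℚ < M) where

    term-pos : ∀ k → 0ℚ < expTerm M k
    term-pos zero = ℚ.positive⁻¹ 1ℚ
    term-pos (suc k) = *-pos (*-pos (term-pos k) 0<M) (0<1/suc k)

    term-scale : ∀ k → fromℕ (suc k) * expTerm M (suc k) ≡ expTerm M k * M
    term-scale k = trans
      (ring10 (expTerm M k * M) (1/suc k) (fromℕ (suc k)))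
      (trans (cong (expTerm M k * M *_) (fromℕ*1/suc k)) (ℚ.*-identityʳ _))

    expSum-cauchy : Cauchy (expSum M)
    expSum-cauchy = go (quotient (M + M) 1ℚ (+-pos 0<M 0<M) (ℚ.positive⁻¹ 1ℚ))
     where
     go : (∃ λ d → 0ℚ < d × (M + M) * d ≡ 1ℚ) → Cauchy (expSum M)
     go (d , 0<d , eq) = squeeze {expSum M} (λ n → expTerm M (suc n) + expTerm M (suc n))
          ((T + T) * M) (*-pos (+-pos (term-pos N) (term-pos N)) 0<M) N
          (λ n _ → p≤p+q (expSum M n) (ℚ.<⇒≤ (term-pos (suc n))))
          (λ n p → begin
             expSum M n + expTerm M (suc n) + (expTerm M (2 ℕ.+ n) + expTerm M (2 ℕ.+ n))
               ≤⟨ ℚ.+-monoʳ-≤ (expSum M (suc n)) (halves (suc n) (ℕ.m≤n⇒m≤1+n p)) ⟩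
             expSum M n + expTerm M (suc n) + expTerm M (suc n)
               ≡⟨ ℚ.+-assoc (expSum M n) _ _ ⟩
             expSum M n + (expTerm M (suc n) + expTerm M (suc n)) ∎)
          (λ n _ → ℚ.<⇒≤ (+-pos (term-pos (suc n)) (term-pos (suc n))))
          (λ n p → begin
             expTerm M (suc n) + expTerm M (suc n)
               ≡⟨ ring11
                    (expTerm M n) M (1/suc n) ⟩
             (expTerm M n + expTerm M n) * (M * 1/suc n)
               ≤⟨ *-mono-≤ (ℚ.<⇒≤ (+-pos (term-pos n) (term-pos n)))
                    (ℚ.<⇒≤ (*-pos 0<M (0<1/suc n)))
                    (ℚ.+-mono-≤ (term≤T (ℕ.≤⇒≤′ p)) (term≤T (ℕ.≤⇒≤′ p))) ℚ.≤-refl ⟩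
             (T + T) * (M * 1/suc n)
               ≡⟨ ℚ.*-assoc (T + T) M (1/suc n) ⟨
             (T + T) * M * 1/suc n ∎)
      where
      open ℚ.≤-Reasoning
      N = proj₁ (archimedean d 0<d)
      h = proj₂ (archimedean d 0<d)
      T = expTerm M N
      halves : ∀ n → N ℕ.≤ n → expTerm M (suc n) + expTerm M (suc n) ≤ expTerm M n
      halves n p = begin
        expTerm M (suc n) + expTerm M (suc n)
          ≡⟨ ring12
               (expTerm M n) M (1/suc n) ⟩
        expTerm M n * ((M + M) * 1/suc n)
          ≤⟨ ℚ.*-monoˡ-≤-nonNeg (expTerm M n) {{nonNegative (ℚ.<⇒≤ (term-pos n))}}
               (ℚ.*-monoˡ-≤-nonNeg (M + M) {{nonNegative (ℚ.<⇒≤ (+-pos 0<M 0<M))}} (ℚ.<⇒≤ (h n p))) ⟩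
        expTerm M n * ((M + M) * d)
          ≡⟨ trans (cong (expTerm M n *_) eq) (ℚ.*-identityʳ _) ⟩
        expTerm M n ∎
      term≤T : ∀ {n} → N ℕ.≤′ n → expTerm M n ≤ T
      term≤T ℕ.≤′-refl = ℚ.≤-refl
      term≤T (ℕ.≤′-step {n} q) = begin
        expTerm M (suc n)         ≡⟨ ℚ.+-identityʳ _ ⟨
        expTerm M (suc n) + 0ℚ    ≤⟨ ℚ.+-monoʳ-≤ (expTerm M (suc n)) (ℚ.<⇒≤ (term-pos (suc n))) ⟩
        expTerm M (suc n) + expTerm M (suc n) ≤⟨ halves n (ℕ.≤′⇒≤ q) ⟩
        expTerm M n               ≤⟨ term≤T q ⟩
        T ∎

    term-bound : ∀ a → ∣ a ∣ ≤ M → ∀ k → ∣ expTerm a k ∣ ≤ expTerm M k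
    term-bound a ha zero = ℚ.≤-refl
    term-bound a ha (suc k) = begin
      ∣ expTerm a k * a * 1/suc k ∣
        ≡⟨ trans (ℚ.∣p*q∣≡∣p∣*∣q∣ (expTerm a k * a) (1/suc k))
             (cong₂ _*_ (ℚ.∣p*q∣≡∣p∣*∣q∣ (expTerm a k) a) (ℚ.0≤p⇒∣p∣≡p (ℚ.<⇒≤ (0<1/suc k)))) ⟩
      ∣ expTerm a k ∣ * ∣ a ∣ * 1/suc k
        ≤⟨ ℚ.*-monoʳ-≤-nonNeg (1/suc k) {{nonNegative (ℚ.<⇒≤ (0<1/suc k))}}
             (*-mono-≤ (ℚ.0≤∣p∣ _) (ℚ.<⇒≤ 0<M) (term-bound a ha k) ha) ⟩
      expTerm M k * M * 1/suc k ∎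
      where open ℚ.≤-Reasoning

    term-lipschitz : ∀ a b → ∣ a ∣ ≤ M → ∣ b ∣ ≤ M → ∀ k →
      ∣ expTerm a (suc k) - expTerm b (suc k) ∣ ≤ expTerm M k * ∣ a - b ∣
    term-lipschitz a b ha hb zero = ℚ.≤-reflexive (trans
      (cong ∣_∣ (ring13 a b))
      (sym (ℚ.*-identityˡ _)))
    term-lipschitz a b ha hb (suc k) = begin
      ∣ A * a * r - B * b * r ∣
        ≡⟨ cong ∣_∣ (ring14 A a r B b) ⟩
      ∣ ((A - B) * a + B * (a - b)) * r ∣
        ≡⟨ trans (ℚ.∣p*q∣≡∣p∣*∣q∣ ((A - B) * a + B * (a - b)) r) (cong (∣ (A - B) * a + B * (a - b) ∣ *_) (ℚ.0≤p⇒∣p∣≡p 0≤r)) ⟩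
      ∣ (A - B) * a + B * (a - b) ∣ * r
        ≤⟨ ℚ.*-monoʳ-≤-nonNeg r {{nonNegative 0≤r}} (begin
             ∣ (A - B) * a + B * (a - b) ∣
               ≤⟨ ℚ.∣p+q∣≤∣p∣+∣q∣ ((A - B) * a) (B * (a - b)) ⟩
             ∣ (A - B) * a ∣ + ∣ B * (a - b) ∣
               ≡⟨ cong₂ _+_ (ℚ.∣p*q∣≡∣p∣*∣q∣ (A - B) a) (ℚ.∣p*q∣≡∣p∣*∣q∣ B (a - b)) ⟩
             ∣ A - B ∣ * ∣ a ∣ + ∣ B ∣ * ∣ a - b ∣
               ≤⟨ ℚ.+-mono-≤
                    (*-mono-≤ (ℚ.0≤∣p∣ (A - B)) (ℚ.<⇒≤ 0<M) (term-lipschitz a b ha hb k) ha)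
                    (ℚ.*-monoʳ-≤-nonNeg ∣ a - b ∣ {{nonNegative (ℚ.0≤∣p∣ (a - b))}} (term-bound b hb (suc k))) ⟩
             t * D * M + t' * D
               ≡⟨ ring15 t D M t' ⟩
             (t * M + t') * D
               ≡⟨ cong (λ z → (z + t') * D) (term-scale k) ⟨
             (fromℕ (suc k) * t' + t') * D
               ≡⟨ cong (_* D) (ring16 (fromℕ (suc k)) t') ⟩
             (fromℕ (suc k) + 1ℚ) * t' * D
               ≡⟨ cong (λ z → z * t' * D) (fromℕ-suc (suc k)) ⟨
             fromℕ (2 ℕ.+ k) * t' * D ∎) ⟩
      fromℕ (2 ℕ.+ k) * t' * D * r
        ≡⟨ ring17 (fromℕ (2 ℕ.+ k)) t' D r ⟩
      fromℕ (2 ℕ.+ k) * r * (t' * D)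
        ≡⟨ trans (cong (_* (t' * D)) (fromℕ*1/suc (suc k))) (ℚ.*-identityˡ _) ⟩
      t' * D ∎
      where
      open ℚ.≤-Reasoning
      A = expTerm a (suc k)
      B = expTerm b (suc k)
      r = 1/suc (suc k)
      0≤r = ℚ.<⇒≤ (0<1/suc (suc k))
      t = expTerm M k
      t' = expTerm M (suc k)
      D = ∣ a - b ∣

    sum-lipschitz : ∀ a b → ∣ a ∣ ≤ M → ∣ b ∣ ≤ M → ∀ n →
      ∣ expSum a n - expSum b n ∣ ≤ expSum M n * ∣ a - b ∣
    sum-lipschitz a b ha hb n = ℚ.≤-trans (go n)
      (ℚ.*-monoʳ-≤-nonNeg ∣ a - b ∣ {{nonNegative (ℚ.0≤∣p∣ (a - b))}}
        (p≤p+q (Σ< n (expTerm M)) (ℚ.<⇒≤ (term-pos n))))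
      where
      open ℚ.≤-Reasoning
      D = ∣ a - b ∣
      go : ∀ n → ∣ expSum a n - expSum b n ∣ ≤ Σ< n (expTerm M) * D
      go zero = ℚ.≤-reflexive (sym (ℚ.*-zeroˡ D))
      go (suc n) = begin
        ∣ expSum a n + expTerm a (suc n) - (expSum b n + expTerm b (suc n)) ∣
          ≡⟨ cong ∣_∣ (ring5
               (expSum a n) (expTerm a (suc n)) (expSum b n) (expTerm b (suc n))) ⟩
        ∣ (expSum a n - expSum b n) + (expTerm a (suc n) - expTerm b (suc n)) ∣
          ≤⟨ ℚ.∣p+q∣≤∣p∣+∣q∣ (expSum a n - expSum b n) (expTerm a (suc n) - expTerm b (suc n)) ⟩
        ∣ expSum a n - expSum b n ∣ + ∣ expTerm a (suc n) - expTerm b (suc n) ∣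
          ≤⟨ ℚ.+-mono-≤ (go n) (term-lipschitz a b ha hb n) ⟩
        Σ< n (expTerm M) * D + expTerm M n * D
          ≡⟨ ℚ.*-distribʳ-+ D (Σ< n (expTerm M)) (expTerm M n) ⟨
        (Σ< n (expTerm M) + expTerm M n) * D ∎

    sum-tail : ∀ a → ∣ a ∣ ≤ M → ∀ {m n} → n ℕ.≤′ m →
      ∣ expSum a m - expSum a n ∣ ≤ ∣ expSum M m - expSum M n ∣
    sum-tail a ha n≤m = ℚ.≤-trans (go n≤m) (≤∣∣ _)
      where
      open ℚ.≤-Reasoning
      go : ∀ {m n} → n ℕ.≤′ m → ∣ expSum a m - expSum a n ∣ ≤ expSum M m - expSum M n
      go {m} ℕ.≤′-refl = ℚ.≤-reflexive
        (trans (cong ∣_∣ (ℚ.+-inverseʳ (expSum a m))) (sym (ℚ.+-inverseʳ (expSum M m))))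
      go {_} {n} (ℕ.≤′-step {m} q) = begin
        ∣ expSum a m + expTerm a (suc m) - expSum a n ∣
          ≡⟨ cong ∣_∣ (ring18
               (expSum a m) (expTerm a (suc m)) (expSum a n)) ⟩
        ∣ (expSum a m - expSum a n) + expTerm a (suc m) ∣
          ≤⟨ ℚ.∣p+q∣≤∣p∣+∣q∣ (expSum a m - expSum a n) (expTerm a (suc m)) ⟩
        ∣ expSum a m - expSum a n ∣ + ∣ expTerm a (suc m) ∣
          ≤⟨ ℚ.+-mono-≤ (go q) (term-bound a ha (suc m)) ⟩
        (expSum M m - expSum M n) + expTerm M (suc m)
          ≡⟨ ring19
               (expSum M m) (expTerm M (suc m)) (expSum M n) ⟩
        expSum M m + expTerm M (suc m) - expSum M n ∎

    sum-tail′ : ∀ a → ∣ a ∣ ≤ M → ∀ m n →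
      ∣ expSum a m - expSum a n ∣ ≤ ∣ expSum M m - expSum M n ∣
    sum-tail′ a ha m n with ℕ.≤-total n m
    ... | inj₁ n≤m = sum-tail a ha (ℕ.≤⇒≤′ n≤m)
    ... | inj₂ m≤n = subst (_≤ ∣ expSum M m - expSum M n ∣)
      (∣-∣-sym (expSum a n) (expSum a m))
      (subst (∣ expSum a n - expSum a m ∣ ≤_) (∣-∣-sym (expSum M n) (expSum M m))
        (sum-tail a ha (ℕ.≤⇒≤′ m≤n)))

  exp-estimate : ∀ x y z C D E → 0ℚ ≤ C → 0ℚ ≤ D → 0ℚ ≤ E →
    ∣ x - y ∣ ≤ C * D → ∣ y - z ∣ ≤ E → ∣ x - z ∣ ≤ (C + 1ℚ) * (D + E)
  exp-estimate x y z C D E 0≤C 0≤D 0≤E h₁ h₂ = begin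
    ∣ x - z ∣                   ≡⟨ cong ∣_∣ (ring20 x y z) ⟩
    ∣ (x - y) + (y - z) ∣       ≤⟨ ℚ.∣p+q∣≤∣p∣+∣q∣ (x - y) (y - z) ⟩
    ∣ x - y ∣ + ∣ y - z ∣       ≤⟨ ℚ.+-mono-≤ h₁ h₂ ⟩
    C * D + E                   ≤⟨ p≤p+q (C * D + E) (ℚ.+-mono-≤ (*-nonNeg 0≤C 0≤E) 0≤D) ⟩
    C * D + E + (C * E + D)     ≡⟨ ring22 C D E ⟩
    (C + 1ℚ) * (D + E)          ∎
    where open ℚ.≤-Reasoning

  exp-cauchy : ∀ {f} → Cauchy f → Cauchy (λ n → expSum (f n) n)
  exp-cauchy {f} cf = go (bounded cf)
    where
    go : Bounded f → Cauchy (λ n → expSum (f n) n)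
    go (M , 0<M , N , hM) = go′ (bounded (expSum-cauchy 0<M))
      where
      go′ : Bounded (expSum M) → Cauchy (λ n → expSum (f n) n)
      go′ (C , 0<C , N′ , hC) = cauchy-by {f} {expSum M} {λ n → expSum (f n) n}
        cf (expSum-cauchy 0<M) (C + 1ℚ) (+-pos 0<C (ℚ.positive⁻¹ 1ℚ)) (N ℕ.+ N′) λ m n pm pn →
          exp-estimate (expSum (f m) m) (expSum (f n) m) (expSum (f n) n)
            C ∣ f m - f n ∣ ∣ expSum M m - expSum M n ∣
            (ℚ.<⇒≤ 0<C) (ℚ.0≤∣p∣ (f m - f n)) (ℚ.0≤∣p∣ (expSum M m - expSum M n))
            (ℚ.≤-trans
              (sum-lipschitz 0<M (f m) (f n) (hM m (ℕ.m+n≤o⇒m≤o N pm)) (hM n (ℕ.m+n≤o⇒m≤o N pn)) m)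
              (ℚ.*-monoʳ-≤-nonNeg ∣ f m - f n ∣ {{ℚ.∣-∣-nonNeg (f m - f n)}}
                (ℚ.≤-trans (≤∣∣ _) (hC m (ℕ.m+n≤o⇒n≤o N pm)))))
            (sum-tail′ 0<M (f n) (hM n (ℕ.m+n≤o⇒m≤o N pn)) m n)

  fraction : ∀ c y → ℚ.toℚᵘ (fromℕ c * 1/suc y) ℚᵘ.≃ ℚᵘ.mkℚᵘ (+ c) 0 ℚᵘ.* ℚᵘ.mkℚᵘ (+ 1) y
  fraction c y = ℚᵘ.≃-trans (ℚ.toℚᵘ-homo-* (fromℕ c) (1/suc y))
    (ℚᵘ.*-cong (ℚ.toℚᵘ-fromℚᵘ (ℚᵘ.mkℚᵘ (+ c) 0)) (ℚ.toℚᵘ-fromℚᵘ (ℚᵘ.mkℚᵘ (+ 1) y)))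

  cross₁ : ∀ c m → + (c ℕ.* suc m) ≡ (+ c ℤ.* + 1) ℤ.* + suc m
  cross₁ c m = trans (ℤ.pos-* c (suc m)) (cong (ℤ._* + suc m) (sym (ℤ.*-identityʳ (+ c))))

  cross₂ : ∀ y → + suc y ≡ + 1 ℤ.* + suc (y ℕ.+ 0)
  cross₂ y = trans (cong (λ z → + suc z) (sym (ℕ.+-identityʳ y))) (sym (ℤ.*-identityˡ (+ suc (y ℕ.+ 0))))

  fraction≤ : ∀ c m y → c ℕ.* suc m ℕ.≤ suc y → fromℕ c * 1/suc y ≤ 1/suc m
  fraction≤ c m y h = ℚ.toℚᵘ-cancel-≤
    (ℚᵘ.≤-respˡ-≃ (ℚᵘ.≃-sym (fraction c y))
    (ℚᵘ.≤-respʳ-≃ (ℚᵘ.≃-sym (ℚ.toℚᵘ-fromℚᵘ (ℚᵘ.mkℚᵘ (+ 1) m)))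
    (ℚᵘ.*≤* (subst₂ ℤ._≤_ (cross₁ c m) (cross₂ y) (ℤ.+≤+ h)))))

  fraction≥ : ∀ c m y → suc y ℕ.≤ c ℕ.* suc m → 1/suc m ≤ fromℕ c * 1/suc y
  fraction≥ c m y h = ℚ.toℚᵘ-cancel-≤
    (ℚᵘ.≤-respʳ-≃ (ℚᵘ.≃-sym (fraction c y))
    (ℚᵘ.≤-respˡ-≃ (ℚᵘ.≃-sym (ℚ.toℚᵘ-fromℚᵘ (ℚᵘ.mkℚᵘ (+ 1) m)))
    (ℚᵘ.*≤* (subst₂ ℤ._≤_ (cross₂ y) (cross₁ c m) (ℤ.+≤+ h)))))

  fromℕ-suc-* : ∀ c q → fromℕ (suc c) * q ≡ fromℕ c * q + q
  fromℕ-suc-* c q = trans (cong (_* q) (fromℕ-suc c)) (sym (ring16 (fromℕ c) q))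

  harmonic-lower : ∀ x c y → x ℕ.+ c ℕ.≤ suc y → harmonic x + fromℕ c * 1/suc y ≤ harmonic (x ℕ.+ c)
  harmonic-lower x zero y h rewrite ℕ.+-identityʳ x =
    ℚ.≤-reflexive (trans (cong (λ q → harmonic x + q) (ℚ.*-zeroˡ (1/suc y))) (ℚ.+-identityʳ (harmonic x)))
  harmonic-lower x (suc c) y h rewrite ℕ.+-suc x c = begin
    harmonic x + fromℕ (suc c) * 1/suc y         ≡⟨ cong (λ q → harmonic x + q) (fromℕ-suc-* c (1/suc y)) ⟩
    harmonic x + (fromℕ c * 1/suc y + 1/suc y)   ≡⟨ ℚ.+-assoc (harmonic x) (fromℕ c * 1/suc y) (1/suc y) ⟨
    harmonic x + fromℕ c * 1/suc y + 1/suc y     ≤⟨ ℚ.+-mono-≤ (harmonic-lower x c y (ℕ.<⇒≤ h))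
                                                      (1/suc-antimono (ℕ.≤-pred h)) ⟩
    harmonic (x ℕ.+ c) + 1/suc (x ℕ.+ c)         ∎
    where open ℚ.≤-Reasoning

  harmonic-upper : ∀ x c → harmonic (x ℕ.+ c) ≤ harmonic x + fromℕ c * 1/suc x
  harmonic-upper x zero rewrite ℕ.+-identityʳ x =
    ℚ.≤-reflexive (sym (trans (cong (λ q → harmonic x + q) (ℚ.*-zeroˡ (1/suc x))) (ℚ.+-identityʳ (harmonic x))))
  harmonic-upper x (suc c) rewrite ℕ.+-suc x c = begin
    harmonic (x ℕ.+ c) + 1/suc (x ℕ.+ c)         ≤⟨ ℚ.+-mono-≤ (harmonic-upper x c) (1/suc-antimono (ℕ.m≤m+n x c)) ⟩
    harmonic x + fromℕ c * 1/suc x + 1/suc x     ≡⟨ ℚ.+-assoc (harmonic x) (fromℕ c * 1/suc x) (1/suc x) ⟩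
    harmonic x + (fromℕ c * 1/suc x + 1/suc x)   ≡⟨ cong (λ q → harmonic x + q) (fromℕ-suc-* c (1/suc x)) ⟨
    harmonic x + fromℕ (suc c) * 1/suc x         ∎
    where open ℚ.≤-Reasoning

  module _ (b : ℕ) where
    private a = suc b

    next : ∀ n → a ℕ.* suc (suc n) ≡ a ℕ.* suc n ℕ.+ a
    next n = trans (ℕ.*-suc a (suc n)) (ℕ.+-comm a (a ℕ.* suc n))

    logSum-incr : ∀ n → logSum a n ≤ logSum a (suc n)
    logSum-incr n = begin
      H₁ - H₂                       ≡⟨ ring23 H₁ H₂ s ⟩
      H₁ + s - (H₂ + s)             ≤⟨ ℚ.+-monoˡ-≤ (- (H₂ + s)) (begin
        H₁ + s                        ≤⟨ ℚ.+-monoʳ-≤ H₁ (fraction≥ a (suc n) y (ℕ.≤-reflexive (sym (next-suc n)))) ⟩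
        H₁ + fromℕ a * 1/suc y        ≤⟨ harmonic-lower (a ℕ.* suc n) a y (ℕ.≤-reflexive (trans (sym (next n)) (next-suc n))) ⟩
        harmonic (a ℕ.* suc n ℕ.+ a)  ≡⟨ cong harmonic (next n) ⟨
        harmonic (a ℕ.* suc (suc n))  ∎) ⟩
      harmonic (a ℕ.* suc (suc n)) - (H₂ + s) ∎
      where
      open ℚ.≤-Reasoning
      H₁ = harmonic (a ℕ.* suc n)
      H₂ = harmonic (suc n)
      s = 1/suc (suc n)
      y = b ℕ.+ a ℕ.* suc n
      next-suc : ∀ n → a ℕ.* suc (suc n) ≡ suc (b ℕ.+ a ℕ.* suc n)
      next-suc n = ℕ.*-suc a (suc n)

    logSum-decr : ∀ n → logSum a (suc n) + 1/suc (suc n) ≤ logSum a n + 1/suc n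
    logSum-decr n = begin
      harmonic (a ℕ.* suc (suc n)) - (H₂ + s) + s ≡⟨ ring24 (harmonic (a ℕ.* suc (suc n))) H₂ s ⟩
      harmonic (a ℕ.* suc (suc n)) - H₂           ≤⟨ ℚ.+-monoˡ-≤ (- H₂) (begin
        harmonic (a ℕ.* suc (suc n))              ≡⟨ cong harmonic (next n) ⟩
        harmonic (a ℕ.* suc n ℕ.+ a)              ≤⟨ harmonic-upper (a ℕ.* suc n) a ⟩
        H₁ + fromℕ a * 1/suc (a ℕ.* suc n)        ≤⟨ ℚ.+-monoʳ-≤ H₁ (fraction≤ a n (a ℕ.* suc n) (ℕ.n≤1+n _)) ⟩
        H₁ + 1/suc n                              ∎) ⟩
      H₁ + 1/suc n - H₂                           ≡⟨ ring18 H₁ (1/suc n) H₂ ⟩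
      H₁ - H₂ + 1/suc n                           ∎
      where
      open ℚ.≤-Reasoning
      H₁ = harmonic (a ℕ.* suc n)
      H₂ = harmonic (suc n)
      s = 1/suc (suc n)

  log-cauchy : ∀ a .{{_ : ℕ.NonZero a}} → Cauchy (logSum a)
  log-cauchy (suc b) = squeeze {logSum (suc b)} 1/suc 1ℚ (ℚ.positive⁻¹ 1ℚ) 0
    (λ n _ → logSum-incr b n) (λ n _ → logSum-decr b n)
    (λ n _ → ℚ.<⇒≤ (0<1/suc n)) (λ n _ → ℚ.≤-reflexive (sym (ℚ.*-identityˡ (1/suc n))))

  ½≤logSum : ∀ b n → ½ ≤ logSum (2 ℕ.+ b) n
  ½≤logSum b zero = ℚ.+-monoˡ-≤ (- harmonic 1) {harmonic 2} (go b)
    where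
    go : ∀ b → harmonic 2 ≤ harmonic ((2 ℕ.+ b) ℕ.* 1)
    go zero = ℚ.≤-refl
    go (suc b) = ℚ.≤-trans (go b) (p≤p+q _ (ℚ.<⇒≤ (0<1/suc ((2 ℕ.+ b) ℕ.* 1))))
  ½≤logSum b (suc n) = ℚ.≤-trans (½≤logSum b n) (logSum-incr (suc b) n)

  apart-from-0 : ∀ e q → 0ℚ + e ≤ q ⊎ q + e ≤ 0ℚ → e ≤ ∣ q ∣
  apart-from-0 e q (inj₁ h) = ℚ.≤-trans (ℚ.≤-reflexive (sym (ℚ.+-identityˡ e))) (ℚ.≤-trans h (≤∣∣ q))
  apart-from-0 e q (inj₂ h) = begin
    e              ≡⟨ ring3′ q e ⟩
    - q + (q + e)  ≤⟨ ℚ.+-monoʳ-≤ (- q) h ⟩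
    - q + 0ℚ       ≡⟨ ℚ.+-identityʳ (- q) ⟩
    - q            ≤⟨ ≤∣∣ (- q) ⟩
    ∣ - q ∣        ≡⟨ ℚ.∣-p∣≡∣p∣ q ⟩
    ∣ q ∣          ∎
    where open ℚ.≤-Reasoning

-- Real numbers

-- Equality of reals is _≈_, not _≡_.
record ℝ : Set where
  constructor mkℝ
  field
    seq    : ℕ → ℚ
    cauchy : Cauchy seq
open ℝ public

open CauchyLemmas
  using (const-cauchy; +-cauchy; neg-cauchy; *-cauchy; inv-cauchy; exp-cauchy; log-cauchy;
         apart-from-0; ½≤logSum)

infixl 6 _+_ _-_
infixl 7 _*_ _/_⟨_⟩
infix  8 -_ _^_
infix  4 _<_ _≤_ _≈_ _#_

fromℚ : ℚ → ℝ
fromℚ q = mkℝ (λ _ → q) (const-cauchy q)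

0ℝ : ℝ
0ℝ = fromℚ 0ℚ

_+_ : ℝ → ℝ → ℝ
x + y = mkℝ (λ n → seq x n ℚ.+ seq y n) (+-cauchy {seq x} {seq y} (cauchy x) (cauchy y))

-_ : ℝ → ℝ
- x = mkℝ (λ n → ℚ.- seq x n) (neg-cauchy {seq x} (cauchy x))

_-_ : ℝ → ℝ → ℝ
x - y = x + - y

_*_ : ℝ → ℝ → ℝ
x * y = mkℝ (λ n → seq x n ℚ.* seq y n) (*-cauchy {seq x} {seq y} (cauchy x) (cauchy y))

_≈_ : ℝ → ℝ → Set
x ≈ y = ∀ e → 0ℚ ℚ.< e → ∃ λ N → ∀ n → N ℕ.≤ n → ℚ.∣ seq x n ℚ.- seq y n ∣ ℚ.< e

_<_ : ℝ → ℝ → Set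
x < y = ∃ λ e → 0ℚ ℚ.< e × ∃ λ N → ∀ n → N ℕ.≤ n → seq x n ℚ.+ e ℚ.≤ seq y n

_≤_ : ℝ → ℝ → Set
x ≤ y = ¬ y < x

-- Apartness, the constructively positive form of x ≠ y.
_#_ : ℝ → ℝ → Set
x # y = x < y ⊎ y < x

_⁻¹⟨_⟩ : (x : ℝ) → x # 0ℝ → ℝ
x ⁻¹⟨ inj₁ (e , 0<e , N , h) ⟩ = mkℝ (λ n → inv (seq x n))
  (inv-cauchy {seq x} (cauchy x) e 0<e N λ n p → apart-from-0 e (seq x n) (inj₂ (h n p)))
x ⁻¹⟨ inj₂ (e , 0<e , N , h) ⟩ = mkℝ (λ n → inv (seq x n))
  (inv-cauchy {seq x} (cauchy x) e 0<e N λ n p → apart-from-0 e (seq x n) (inj₁ (h n p)))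

_/_⟨_⟩ : (x y : ℝ) → y # 0ℝ → ℝ
x / y ⟨ y#0 ⟩ = x * y ⁻¹⟨ y#0 ⟩

-- The power series Σ xᵏ/k!, with the n-th partial sum evaluated at the n-th
-- approximation of x.
exp : ℝ → ℝ
exp x = mkℝ (λ n → expSum (seq x n) n) (exp-cauchy {seq x} (cauchy x))

-- The natural logarithm ∫₁ᵃ dx/x of a positive integer a.
log : (a : ℕ) .{{_ : ℕ.NonZero a}} → ℝ
log a = mkℝ (logSum a) (log-cauchy a)

log#0 : ∀ b → log (2 ℕ.+ b) # 0ℝ
log#0 b = inj₂ (½ , ℚ.positive⁻¹ ½ , 0 , λ n _ →
  subst (ℚ._≤ logSum (2 ℕ.+ b) n) (sym (ℚ.+-identityˡ ½)) (½≤logSum b n))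

_^_ : (a : ℕ) .{{_ : ℕ.NonZero a}} → ℝ → ℝ
a ^ x = exp (x * log a)

-- Three-dimensional space

record ℝ³ : Set where
  constructor ⟨_,_,_⟩
  field
    x y z : ℝ

infixl 6 _+ᵥ_
infixr 7 _*ᵥ_
infix  7 _∙_ _×ᵥ_
infix  4 _≈ᵥ_ _#ᵥ_ _∦_ _∈ᴸ_

0ᵥ : ℝ³
0ᵥ = ⟨ 0ℝ , 0ℝ , 0ℝ ⟩

_+ᵥ_ : ℝ³ → ℝ³ → ℝ³
⟨ a , b , c ⟩ +ᵥ ⟨ a′ , b′ , c′ ⟩ = ⟨ a + a′ , b + b′ , c + c′ ⟩

_*ᵥ_ : ℝ → ℝ³ → ℝ³
t *ᵥ ⟨ a , b , c ⟩ = ⟨ t * a , t * b , t * c ⟩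

_∙_ : ℝ³ → ℝ³ → ℝ
⟨ a , b , c ⟩ ∙ ⟨ a′ , b′ , c′ ⟩ = a * a′ + b * b′ + c * c′

_×ᵥ_ : ℝ³ → ℝ³ → ℝ³
⟨ a , b , c ⟩ ×ᵥ ⟨ a′ , b′ , c′ ⟩ =
  ⟨ b * c′ - c * b′ , c * a′ - a * c′ , a * b′ - b * a′ ⟩

_≈ᵥ_ : ℝ³ → ℝ³ → Set
⟨ a , b , c ⟩ ≈ᵥ ⟨ a′ , b′ , c′ ⟩ = a ≈ a′ × b ≈ b′ × c ≈ c′

_#ᵥ_ : ℝ³ → ℝ³ → Set
⟨ a , b , c ⟩ #ᵥ ⟨ a′ , b′ , c′ ⟩ = a # a′ ⊎ b # b′ ⊎ c # c′

-- u and w are linearly independent, i.e. (for nonzero u and w) not parallel.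
_∦_ : ℝ³ → ℝ³ → Set
u ∦ w = u ×ᵥ w #ᵥ 0ᵥ

record Line : Set where
  field
    base        : ℝ³
    direction   : ℝ³
    direction#0 : direction #ᵥ 0ᵥ
open Line public

_∈ᴸ_ : ℝ³ → Line → Set
p ∈ᴸ ℓ = ∃ λ t → p ≈ᵥ base ℓ +ᵥ t *ᵥ direction ℓ

Skew : Line → Line → Set
Skew ℓ m = direction ℓ ∦ direction m × (∀ p q → p ∈ᴸ ℓ → q ∈ᴸ m → p #ᵥ q)

-- w is the projection of u along v onto the plane v^⊥.
IsProjection : (v u w : ℝ³) → Set
IsProjection v u w = w ∙ v ≈ 0ℝ × ∃ λ t → w +ᵥ t *ᵥ v ≈ᵥ u

record Configuration (v : ℝ³) (n : ℕ) : Set where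
  field
    line : Fin n → Line
    skew : ∀ i j → i ≢ j → Skew (line i) (line j)
    notParallel : ∀ i → direction (line i) ∦ v
    projectionsNotParallel : ∀ i j → i ≢ j → ∀ d e →
      IsProjection v (direction (line i)) d →
      IsProjection v (direction (line j)) e →
      d ∦ e
open Configuration public

CrossesOver : ℝ³ → Line → Line → Set
CrossesOver v ℓ₁ ℓ₂ = ∃ λ p → ∃₂ λ z₁ z₂ →
  p ∙ v ≈ 0ℝ × p +ᵥ z₁ *ᵥ v ∈ᴸ ℓ₁ × p +ᵥ z₂ *ᵥ v ∈ᴸ ℓ₂ × z₂ < z₁

-- Lines are pairwise skew, so distinct indices are distinct lines and ∣ s ∣ is
-- the number of lines in the subset.
Stacked : ∀ {v n} → Configuration v n → Subset n → Set
Stacked {v} 𝓛 s = IsStrictTotalOrder {A = ∃ (_∈ s)}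
  (_≡_ on proj₁)
  ((λ i j → CrossesOver v (line 𝓛 i) (line 𝓛 j)) on proj₁)

Admissible : ℝ → Set
Admissible ε = 0ℝ ≤ ε × ∃ λ c → 0ℝ < c ×
  (∀ n .{{_ : ℕ.NonZero n}} v → v #ᵥ 0ᵥ → (𝓛 : Configuration v n) →
     ∃ λ s → Stacked 𝓛 s × c * n ^ ε ≤ fromℚ (fromℕ Subset.∣ s ∣))

-- The supremum of a set of reals need not exist constructively as a Cauchy
-- real, but sup A ≤ b means that b is an upper bound of A.
sup[_]≤_ : (ℝ → Set) → ℝ → Set
sup[ A ]≤ b = ∀ x → A x → x ≤ b

{-# OPTIONS --safe #-}

-- Seven lines can realise the Paley tournament on ℤ/7, whose transitive
-- subtournaments have at most three vertices. Take v = (0,0,1). For the lines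
-- y = a x + b, z = c x + d, which line is above at the crossing is the sign of a
-- form homogeneous of degree three in the differences of (a,b,c,d). Hence
-- replacing every line by a copy of a configuration, scaled by a small ε in the
-- (a,b,c,d)-space and translated to that line, realises the lexicographic product
-- of the two tournaments. Iterating gives 7ᵏ lines without a stacked subset of
-- more than 3ᵏ lines. If t log 7 ≥ log 3 + d, then (7ᵏ)^t ≥ (1 + k d) 3ᵏ, which
-- exceeds 3ᵏ/c for large k.
module Submission where

import Data.Fin.Properties as Fin
open import Data.Fin.Base using (Fin; zero; suc; toℕ; combine; remQuot; _↑ˡ_; _↑ʳ_)
open import Data.Fin.Properties using (all?; combine-remQuot; remQuot-combine)
open import Data.Fin.Subset as Subset using (Subset; inside; outside)
open import Data.Fin.Subset.Properties using (_∈?_; nonempty?; anySubset?; Empty-unique; ∣⊥∣≡0; ∣p∣≤n)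
open import Data.Nat.Base as ℕ using (ℕ; zero; suc; nonZero)
open import Data.Nat.DivMod using (_%_)
import Data.Nat.Properties as ℕ
open import Data.Product using (∃; _×_; _,_; proj₁; proj₂)
open import Data.Rational.Base as ℚ using (ℚ; 0ℚ; 1ℚ; ½; positive; negative; nonNegative)
import Data.Rational.Properties as ℚ
open import Data.Sum as Sum using (_⊎_; inj₁; inj₂)
open import Data.Vec.Base using (Vec; []; _∷_; here; there; _++_; splitAt; lookup)
open import Data.Vec.Properties using ([]=⇒lookup; lookup⇒[]=; lookup-++ˡ; lookup-++ʳ)
open import Function.Base using (_∘_)
open import Level using (0ℓ)
open import Relation.Binary.Core using (Rel)
open import Relation.Binary.Definitions using (tri<; tri≈; tri>)
open import Relation.Binary.PropositionalEquality
  using (_≡_; _≢_; refl; sym; trans; cong; cong₂; subst; subst₂)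
open import Relation.Binary.Structures using (IsStrictTotalOrder)
open import Relation.Nullary using (¬_; Dec; yes; no; contradiction)
open import Relation.Nullary.Decidable using (_→-dec_; _×-dec_; _⊎-dec_; ¬?; from-yes; from-no)
open import Tactic.RingSolver using (solve-∀)
open import Defs using
  (fromℕ; 1/suc; Σ<; inv; expTerm; expSum; harmonic; logSum; Cauchy; module CauchyLemmas)
open CauchyLemmas

-- Exponential and logarithm are given by sequences of partial sums, and no functional equation for
-- them is proved. The growth estimate is instead a chain of inequalities between finite sums: a
-- factor 1 + x on a partial sum at s is absorbed by the next partial sum at s + x, and for x = 1/i
-- the factors telescope to an integer while the increments add up to a logarithm sum. Each factor
-- costs one more term of the exponential series; with the mesh fixed in advance, the total cost
-- depends on k alone and is covered by all late approximations.
--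
-- Heights of real points cannot be compared by a decision procedure, so no crossing point is
-- constructed. The coefficients are rational, where the sign of the cubic form is decidable, and
-- crossings enter only through the implication from crossing to sign. The converse is needed only
-- inside a stacked set, where trichotomy of its order supplies it.

module Tournaments where

  -- Acyclic vertex sets and lexicographic products of tournaments.

  open import Data.Nat.Base using (_+_; _*_; _∸_; _≤_; z≤n)
  open import Data.Fin.Subset using (_∈_; ∣_∣)

  -- A tournament is transitive exactly when it has no directed triangle. In this negative form the
  -- condition passes to subsets and to sets of representatives without mention of a linear order.
  Acyclic : ∀ {n} → Rel (Fin n) 0ℓ → Subset n → Set
  Acyclic _⇒_ s = ∀ i j l → i ∈ s → j ∈ s → l ∈ s → i ⇒ j → j ⇒ l → ¬ l ⇒ i

  ∣++∣ : ∀ {m n} (s : Subset m) (t : Subset n) → ∣ s ++ t ∣ ≡ ∣ s ∣ + ∣ t ∣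
  ∣++∣ [] t = refl
  ∣++∣ (inside  ∷ s) t = cong suc (∣++∣ s t)
  ∣++∣ (outside ∷ s) t = ∣++∣ s t

  ∈-++⁺ˡ : ∀ {m n} {s : Subset m} {t : Subset n} {i} → i ∈ s → i ↑ˡ n ∈ s ++ t
  ∈-++⁺ˡ {s = s} {t} {i} i∈s = lookup⇒[]= _ _ (trans (lookup-++ˡ s t i) ([]=⇒lookup i∈s))

  ∈-++⁺ʳ : ∀ {m n} {s : Subset m} {t : Subset n} {i} → i ∈ t → m ↑ʳ i ∈ s ++ t
  ∈-++⁺ʳ {s = s} {t} {i} i∈t = lookup⇒[]= _ _ (trans (lookup-++ʳ s t i) ([]=⇒lookup i∈t))

  -- Counts `s` block by block: `t` collects the blocks that `s` meets, each of which holds at most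
  -- `M` elements of `s` and supplies a representative.
  projection : ∀ n {m} M (s : Subset (n * m)) →
    (∀ (i : Fin n) (u : Subset m) → (∀ {j} → j ∈ u → combine i j ∈ s) → ∣ u ∣ ≤ M) →
    ∃ λ (t : Subset n) → ∣ s ∣ ≤ ∣ t ∣ * M × (∀ {i} → i ∈ t → ∃ λ j → combine i j ∈ s)
  projection zero M [] _ = [] , z≤n , λ ()
  projection (suc n) {m} M s fibre with splitAt m s
  ... | u , s′ , refl with projection n M s′ (λ i v v⊆ → fibre (suc i) v (∈-++⁺ʳ {s = u} ∘ v⊆)) | nonempty? u
  ... | t , s′≤ , occupied | yes (j , j∈u) = inside ∷ t , ∣s∣≤ , occupied′
    where
    ∣s∣≤ : ∣ u ++ s′ ∣ ≤ M + ∣ t ∣ * M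
    ∣s∣≤ = subst (_≤ M + ∣ t ∣ * M) (sym (∣++∣ u s′)) (ℕ.+-mono-≤ (fibre zero u ∈-++⁺ˡ) s′≤)
    occupied′ : ∀ {i} → i ∈ inside ∷ t → ∃ λ j → combine i j ∈ u ++ s′
    occupied′ here = j , ∈-++⁺ˡ j∈u
    occupied′ (there i∈t) = let k , p = occupied i∈t in k , ∈-++⁺ʳ {s = u} p
  ... | t , s′≤ , occupied | no empty = outside ∷ t , ∣s∣≤ , occupied′
    where
    ∣s∣≤ : ∣ u ++ s′ ∣ ≤ ∣ t ∣ * M
    ∣s∣≤ = subst (_≤ ∣ t ∣ * M)
      (sym (trans (∣++∣ u s′) (cong (_+ ∣ s′ ∣) (trans (cong ∣_∣ (Empty-unique empty)) (∣⊥∣≡0 m))))) s′≤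
    occupied′ : ∀ {i} → i ∈ outside ∷ t → ∃ λ j → combine i j ∈ u ++ s′
    occupied′ (there i∈t) = let k , p = occupied i∈t in k , ∈-++⁺ʳ {s = u} p

  -- The part of `s` in one block is acyclic for `_⇝_`. Representatives of the blocks that `s` meets
  -- form an acyclic set for `_⇒_`, since arcs between blocks do not depend on the chosen
  -- representatives.
  acyclic-lexicographic : ∀ {n m A B} {_⇒_ : Rel (Fin n) 0ℓ} {_⇝_ : Rel (Fin m) 0ℓ} {_▷_ : Rel (Fin (n * m)) 0ℓ} →
    (∀ i i′ j j′ → i ⇒ i′ → combine i j ▷ combine i′ j′) →
    (∀ i {j j′} → j ⇝ j′ → combine i j ▷ combine i j′) →
    (∀ t → Acyclic _⇒_ t → ∣ t ∣ ≤ A) → (∀ u → Acyclic _⇝_ u → ∣ u ∣ ≤ B) →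
    ∀ s → Acyclic _▷_ s → ∣ s ∣ ≤ A * B
  acyclic-lexicographic {n} {B = B} outer inner ≤A ≤B s acyclic
    with projection n B s (λ i u u⊆ → ≤B u λ j k l j∈ k∈ l∈ p q r →
      acyclic (combine i j) (combine i k) (combine i l) (u⊆ j∈) (u⊆ k∈) (u⊆ l∈) (inner i p) (inner i q) (inner i r))
  ... | t , s≤ , occupied = ℕ.≤-trans s≤ (ℕ.*-monoˡ-≤ B (≤A t λ i j k i∈ j∈ k∈ p q r →
    let i′ , pi = occupied i∈
        j′ , pj = occupied j∈
        k′ , pk = occupied k∈
    in acyclic (combine i i′) (combine j j′) (combine k k′) pi pj pk (outer i j i′ j′ p) (outer j k j′ k′ q) (outer k i k′ i′ r)))

  -- The Paley tournament: 1, 2 and 4 are the nonzero squares modulo 7.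
  Paley : Rel (Fin 7) 0ℓ
  Paley i j = d ≡ 1 ⊎ d ≡ 2 ⊎ d ≡ 4
    where d = (7 + toℕ j ∸ toℕ i) % 7

  paley? : ∀ i j → Dec (Paley i j)
  paley? i j = (d ℕ.≟ 1) ⊎-dec (d ℕ.≟ 2) ⊎-dec (d ℕ.≟ 4)
    where d = (7 + toℕ j ∸ toℕ i) % 7

  acyclic? : ∀ t → Dec (Acyclic Paley t)
  acyclic? t = all? λ i → all? λ j → all? λ l →
    i ∈? t →-dec j ∈? t →-dec l ∈? t →-dec paley? i j →-dec paley? j l →-dec ¬? (paley? l i)

  -- The out-neighbours i + 1, i + 2, i + 4 of a vertex i form a directed triangle, so a transitive
  -- set with source i contains at most two of them. Here all 128 subsets are simply searched.
  paley-acyclic-≤3 : ∀ t → Acyclic Paley t → ∣ t ∣ ≤ 3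
  paley-acyclic-≤3 t acyclic = ℕ.≮⇒≥ λ 3<∣t∣ →
    from-no (anySubset? λ t → (4 ℕ.≤? ∣ t ∣) ×-dec acyclic? t) (t , 3<∣t∣ , acyclic)

open Tournaments

-- Natural numbers as rationals, and monotonicity of products.

module Rationals where
  open import Data.Rational.Base using (_+_; _*_; -_; _≤_; _<_)
  open ℚ.≤-Reasoning

  neg-involutive : ∀ q → - - q ≡ q
  neg-involutive = solve-∀ ℚ-ring

  fromℕ-+ : ∀ m n → fromℕ (m ℕ.+ n) ≡ fromℕ m + fromℕ n
  fromℕ-+ zero n = sym (ℚ.+-identityˡ (fromℕ n))
  fromℕ-+ (suc m) n = trans (fromℕ-suc (m ℕ.+ n)) (trans (cong (_+ 1ℚ) (fromℕ-+ m n))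
    (trans (swap (fromℕ m) (fromℕ n)) (cong (_+ fromℕ n) (sym (fromℕ-suc m)))))
    where
    swap : ∀ x y → x + y + 1ℚ ≡ x + 1ℚ + y
    swap = solve-∀ ℚ-ring

  fromℕ-* : ∀ m n → fromℕ (m ℕ.* n) ≡ fromℕ m * fromℕ n
  fromℕ-* zero n = sym (ℚ.*-zeroˡ (fromℕ n))
  fromℕ-* (suc m) n = begin-equality
    fromℕ (n ℕ.+ m ℕ.* n)          ≡⟨ fromℕ-+ n (m ℕ.* n) ⟩
    fromℕ n + fromℕ (m ℕ.* n)      ≡⟨ cong (λ q → fromℕ n + q) (fromℕ-* m n) ⟩
    fromℕ n + fromℕ m * fromℕ n    ≡⟨ ℚ.+-comm (fromℕ n) (fromℕ m * fromℕ n) ⟩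
    fromℕ m * fromℕ n + fromℕ n    ≡⟨ fromℕ-suc-* m (fromℕ n) ⟨
    fromℕ (suc m) * fromℕ n        ∎

  0≤fromℕ : ∀ n → 0ℚ ≤ fromℕ n
  0≤fromℕ n = ℚ.nonNegative⁻¹ _ {{ℚ.normalize-nonNeg n 1}}

  0<fromℕ-suc : ∀ n → 0ℚ < fromℕ (suc n)
  0<fromℕ-suc n = ℚ.positive⁻¹ _ {{ℚ.normalize-pos (suc n) 1}}

  fromℕ-mono-≤ : ∀ {m n} → m ℕ.≤ n → fromℕ m ≤ fromℕ n
  fromℕ-mono-≤ {m} {n} m≤n = begin
    fromℕ m                      ≤⟨ p≤p+q (fromℕ m) (0≤fromℕ (n ℕ.∸ m)) ⟩
    fromℕ m + fromℕ (n ℕ.∸ m)    ≡⟨ fromℕ-+ m (n ℕ.∸ m) ⟨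
    fromℕ (m ℕ.+ (n ℕ.∸ m))      ≡⟨ cong fromℕ (ℕ.m+[n∸m]≡n m≤n) ⟩
    fromℕ n                      ∎

  *-monoʳ-≤ : ∀ {r} → 0ℚ ≤ r → ∀ {p q} → p ≤ q → r * p ≤ r * q
  *-monoʳ-≤ {r} 0≤r = ℚ.*-monoˡ-≤-nonNeg r {{nonNegative 0≤r}}

  *-monoˡ-≤ : ∀ {r} → 0ℚ ≤ r → ∀ {p q} → p ≤ q → p * r ≤ q * r
  *-monoˡ-≤ {r} 0≤r = ℚ.*-monoʳ-≤-nonNeg r {{nonNegative 0≤r}}

open Rationals

Eventually : (ℕ → Set) → Set
Eventually P = ∃ λ N → ∀ n → N ℕ.≤ n → P n

eventually-× : ∀ {P Q R : ℕ → Set} → (∀ n → P n → Q n → R n) → Eventually P → Eventually Q → Eventually R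
eventually-× f (M , p) (N , q) =
  M ℕ.+ N , λ n M+N≤n → f n (p n (ℕ.m+n≤o⇒m≤o M M+N≤n)) (q n (ℕ.m+n≤o⇒n≤o M M+N≤n))

witness : ∀ {P : Set} → Eventually (λ _ → P) → P
witness (N , p) = p N ℕ.≤-refl

-- Exponential partial sums evaluated at logarithm sums.

module ExponentialGrowth where
  open import Data.Rational.Base using (_+_; _*_; _-_; -_; _≤_; _<_)
  open ℚ.≤-Reasoning

  -- The first two terms of the binomial expansion of (s + x)ʲ⁺¹/(j+1)!.
  expTerm-+ : ∀ {s x} → 0ℚ < s → 0ℚ ≤ x → ∀ j →
    expTerm s (suc j) + x * expTerm s j ≤ expTerm (s + x) (suc j)
  expTerm-+ {s} {x} 0<s 0≤x zero = ℚ.≤-reflexive (eq s x)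
    where
    eq : ∀ s x → 1ℚ * s * 1ℚ + x * 1ℚ ≡ 1ℚ * (s + x) * 1ℚ
    eq = solve-∀ ℚ-ring
  expTerm-+ {s} {x} 0<s 0≤x (suc j) = begin
    t₁ * s * r + x * t₁
      ≡⟨ cong (λ q → t₁ * s * r + x * q) lead ⟩
    t₁ * s * r + x * ((t₁ + t * s) * r)
      ≤⟨ p≤p+q _ (*-nonNeg (*-nonNeg (*-nonNeg 0≤x 0≤x) (ℚ.<⇒≤ (term-pos 0<s j))) 0≤r) ⟩
    t₁ * s * r + x * ((t₁ + t * s) * r) + x * x * t * r
      ≡⟨ expand t₁ s r x t ⟩
    (t₁ + x * t) * (s + x) * r
      ≤⟨ *-monoˡ-≤ 0≤r (*-monoˡ-≤ (ℚ.+-mono-≤ (ℚ.<⇒≤ 0<s) 0≤x) (expTerm-+ 0<s 0≤x j)) ⟩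
    expTerm (s + x) (suc j) * (s + x) * r ∎
    where
    t = expTerm s j
    t₁ = expTerm s (suc j)
    r = 1/suc (suc j)
    0≤r = ℚ.<⇒≤ (0<1/suc (suc j))
    expand : ∀ t₁ s r x t →
      t₁ * s * r + x * ((t₁ + t * s) * r) + x * x * t * r ≡ (t₁ + x * t) * (s + x) * r
    expand = solve-∀ ℚ-ring
    regroup : ∀ n r t₁ → (t₁ + n * t₁) * r ≡ (n + 1ℚ) * r * t₁
    regroup = solve-∀ ℚ-ring
    lead : t₁ ≡ (t₁ + t * s) * r
    lead = sym (begin-equality
      (t₁ + t * s) * r                    ≡⟨ cong (λ q → (t₁ + q) * r) (term-scale 0<s j) ⟨
      (t₁ + fromℕ (suc j) * t₁) * r       ≡⟨ regroup (fromℕ (suc j)) r t₁ ⟩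
      (fromℕ (suc j) + 1ℚ) * r * t₁       ≡⟨ cong (λ q → q * r * t₁) (fromℕ-suc (suc j)) ⟨
      fromℕ (suc (suc j)) * r * t₁        ≡⟨ cong (_* t₁) (fromℕ*1/suc (suc j)) ⟩
      1ℚ * t₁                             ≡⟨ ℚ.*-identityˡ t₁ ⟩
      t₁                                  ∎)

  -- A finite form of (1 + x) exp s ≤ exp (s + x): x times the term of degree j is charged to the
  -- term of degree j + 1, hence the one extra summand on the right.
  expSum-+ : ∀ {s x} → 0ℚ < s → 0ℚ ≤ x → ∀ n →
    expSum s n + x * expSum s n ≤ expSum (s + x) (suc n)
  expSum-+ {s} {x} 0<s 0≤x n = ℚ.≤-trans
    (ℚ.+-monoˡ-≤ (x * expSum s n) (p≤p+q (expSum s n) (ℚ.<⇒≤ (term-pos 0<s (suc n))))) (go n)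
    where
    swap : ∀ e t x e′ t′ → e + t + x * (e′ + t′) ≡ e + x * e′ + (t + x * t′)
    swap = solve-∀ ℚ-ring
    go : ∀ n → expSum s (suc n) + x * expSum s n ≤ expSum (s + x) (suc n)
    go zero = begin
      1ℚ + expTerm s 1 + x * (0ℚ + 1ℚ)          ≡⟨ swap 1ℚ (expTerm s 1) x 0ℚ 1ℚ ⟩
      1ℚ + x * 0ℚ + (expTerm s 1 + x * 1ℚ)      ≡⟨ cong (λ q → 1ℚ + q + (expTerm s 1 + x * 1ℚ)) (ℚ.*-zeroʳ x) ⟩
      1ℚ + (expTerm s 1 + x * 1ℚ)               ≤⟨ ℚ.+-monoʳ-≤ 1ℚ (expTerm-+ 0<s 0≤x 0) ⟩
      1ℚ + expTerm (s + x) 1                    ∎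
    go (suc n) = begin
      expSum s (suc n) + expTerm s (2 ℕ.+ n) + x * (expSum s n + expTerm s (suc n))
        ≡⟨ swap (expSum s (suc n)) (expTerm s (2 ℕ.+ n)) x (expSum s n) (expTerm s (suc n)) ⟩
      expSum s (suc n) + x * expSum s n + (expTerm s (2 ℕ.+ n) + x * expTerm s (suc n))
        ≤⟨ ℚ.+-mono-≤ (go n) (expTerm-+ 0<s 0≤x (suc n)) ⟩
      expSum (s + x) (suc n) + expTerm (s + x) (2 ℕ.+ n) ∎

  expSum-monoʳ-≤ : ∀ {s m n} → 0ℚ < s → m ℕ.≤ n → expSum s m ≤ expSum s n
  expSum-monoʳ-≤ {s} 0<s m≤n = go (ℕ.≤⇒≤′ m≤n)
    where
    go : ∀ {m n} → m ℕ.≤′ n → expSum s m ≤ expSum s n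
    go ℕ.≤′-refl = ℚ.≤-refl
    go (ℕ.≤′-step {n} p) = ℚ.≤-trans (go p) (p≤p+q _ (ℚ.<⇒≤ (term-pos 0<s (suc n))))

  expSum-monoˡ-≤ : ∀ {s t} → 0ℚ < s → s ≤ t → ∀ n → expSum s n ≤ expSum t n
  expSum-monoˡ-≤ {s} {t} 0<s s≤t n = go (suc n)
    where
    go : ∀ n → Σ< n (expTerm s) ≤ Σ< n (expTerm t)
    go zero = ℚ.≤-refl
    go (suc n) = ℚ.+-mono-≤ (go n) (ℚ.≤-trans (≤∣∣ _)
      (term-bound (ℚ.<-≤-trans 0<s s≤t) s
        (subst (_≤ t) (sym (ℚ.0≤p⇒∣p∣≡p (ℚ.<⇒≤ 0<s))) s≤t) n))

  harmonic-mono-≤ : ∀ m n → harmonic m ≤ harmonic (m ℕ.+ n)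
  harmonic-mono-≤ m zero rewrite ℕ.+-identityʳ m = ℚ.≤-refl
  harmonic-mono-≤ m (suc n) rewrite ℕ.+-suc m n =
    ℚ.≤-trans (harmonic-mono-≤ m n) (p≤p+q _ (ℚ.<⇒≤ (0<1/suc (m ℕ.+ n))))

  -- The product of the factors 1 + 1/i over m < i ≤ m + n telescopes.
  expSum-harmonic : ∀ {s} → 0ℚ < s → ∀ l m n →
    fromℕ (suc (m ℕ.+ n)) * expSum s l ≤
    fromℕ (suc m) * expSum (s + (harmonic (m ℕ.+ n) - harmonic m)) (n ℕ.+ l)
  expSum-harmonic {s} 0<s l m zero rewrite ℕ.+-identityʳ m =
    ℚ.≤-reflexive (cong (λ q → fromℕ (suc m) * expSum q l)
      (sym (trans (cong (λ q → s + q) (ℚ.+-inverseʳ (harmonic m))) (ℚ.+-identityʳ s))))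
  expSum-harmonic {s} 0<s l m (suc n) rewrite ℕ.+-suc m n = begin
    fromℕ (2 ℕ.+ (m ℕ.+ n)) * e          ≡⟨ cong (_* e) (fromℕ-suc (suc (m ℕ.+ n))) ⟩
    (f + 1ℚ) * e                         ≡⟨ cong (λ q → (f + q) * e) (fromℕ*1/suc (m ℕ.+ n)) ⟨
    (f + f * r) * e                      ≡⟨ factor f r e ⟩
    f * e + r * (f * e)                  ≤⟨ ℚ.+-mono-≤ ih (*-monoʳ-≤ 0≤r ih) ⟩
    g * e′ + r * (g * e′)                ≡⟨ factor′ g r e′ ⟩
    g * (e′ + r * e′)                    ≤⟨ *-monoʳ-≤ (0≤fromℕ (suc m)) (expSum-+ 0<s′ 0≤r (n ℕ.+ l)) ⟩
    g * expSum (s + (h - harmonic m) + r) (suc (n ℕ.+ l))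
      ≡⟨ cong (λ q → g * expSum q (suc (n ℕ.+ l))) (shift s h (harmonic m) r) ⟩
    g * expSum (s + (h + r - harmonic m)) (suc (n ℕ.+ l)) ∎
    where
    f = fromℕ (suc (m ℕ.+ n))
    g = fromℕ (suc m)
    r = 1/suc (m ℕ.+ n)
    0≤r = ℚ.<⇒≤ (0<1/suc (m ℕ.+ n))
    h = harmonic (m ℕ.+ n)
    e = expSum s l
    e′ = expSum (s + (h - harmonic m)) (n ℕ.+ l)
    ih = expSum-harmonic 0<s l m n
    0<s′ : 0ℚ < s + (h - harmonic m)
    0<s′ = ℚ.+-mono-<-≤ 0<s (p≤q⇒0≤q-p (harmonic-mono-≤ m n))
    factor : ∀ f r e → (f + f * r) * e ≡ f * e + r * (f * e)
    factor = solve-∀ ℚ-ring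
    factor′ : ∀ g r e → g * e + r * (g * e) ≡ g * (e + r * e)
    factor′ = solve-∀ ℚ-ring
    shift : ∀ s h x r → s + (h - x) + r ≡ s + (h + r - x)
    shift = solve-∀ ℚ-ring

  -- logSum a m falls short of log a by at most 1/(m + 1).
  expSum-logSum : ∀ b m {s} → 0ℚ < s → ∀ l →
    fromℕ (suc b) * expSum s l ≤ expSum (s + (logSum (suc b) m + 1/suc m)) (b ℕ.* suc m ℕ.+ l)
  expSum-logSum b m {s} 0<s l = ℚ.≤-trans
    (ℚ.*-cancelˡ-≤-pos (fromℕ (suc m)) {{positive (0<fromℕ-suc m)}} (begin
      fromℕ (suc m) * (fromℕ (suc b) * expSum s l)   ≡⟨ rearrange (fromℕ (suc m)) (fromℕ (suc b)) (expSum s l) ⟩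
      fromℕ (suc b) * fromℕ (suc m) * expSum s l     ≡⟨ cong (_* expSum s l) (fromℕ-* (suc b) (suc m)) ⟨
      fromℕ (suc b ℕ.* suc m) * expSum s l           ≤⟨ expSum-harmonic 0<s l m (b ℕ.* suc m) ⟩
      fromℕ (suc m) * expSum (s + h) (b ℕ.* suc m ℕ.+ l) ∎))
    (expSum-monoˡ-≤ (ℚ.+-mono-<-≤ 0<s 0≤h) (ℚ.+-monoʳ-≤ s (begin
      harmonic (m ℕ.+ b ℕ.* suc m) - harmonic m     ≤⟨ ℚ.+-monoˡ-≤ (- harmonic m)
                                                         (p≤p+q (harmonic (m ℕ.+ b ℕ.* suc m)) (ℚ.<⇒≤ (0<1/suc (m ℕ.+ b ℕ.* suc m)))) ⟩
      harmonic (suc b ℕ.* suc m) - harmonic m       ≡⟨ shift (harmonic (suc b ℕ.* suc m)) (harmonic m) (1/suc m) ⟩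
      logSum (suc b) m + 1/suc m                    ∎)) (b ℕ.* suc m ℕ.+ l))
    where
    h = harmonic (m ℕ.+ b ℕ.* suc m) - harmonic m
    0≤h : 0ℚ ≤ h
    0≤h = p≤q⇒0≤q-p (harmonic-mono-≤ m (b ℕ.* suc m))
    rearrange : ∀ x y z → x * (y * z) ≡ y * x * z
    rearrange = solve-∀ ℚ-ring
    shift : ∀ x y r → x - y ≡ x - (y + r) + r
    shift = solve-∀ ℚ-ring

  0≤logSum : ∀ b m → 0ℚ ≤ logSum (suc b) m
  0≤logSum b m = p≤q⇒0≤q-p (harmonic-mono-≤ (suc m) (b ℕ.* suc m))

  expSum-power : ∀ b m {s} → 0ℚ < s → ∀ l k →
    fromℕ (suc b ℕ.^ k) * expSum s l ≤
    expSum (s + fromℕ k * (logSum (suc b) m + 1/suc m)) (k ℕ.* (b ℕ.* suc m) ℕ.+ l)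
  expSum-power b m {s} 0<s l zero = ℚ.≤-reflexive (trans (ℚ.*-identityˡ (expSum s l))
    (cong (λ q → expSum q l) (sym (trans (cong (λ q → s + q) (ℚ.*-zeroˡ (logSum (suc b) m + 1/suc m))) (ℚ.+-identityʳ s)))))
  expSum-power b m {s} 0<s l (suc k) = begin
    fromℕ (a ℕ.* a ℕ.^ k) * e               ≡⟨ cong (_* e) (fromℕ-* a (a ℕ.^ k)) ⟩
    fromℕ a * fromℕ (a ℕ.^ k) * e           ≡⟨ ℚ.*-assoc (fromℕ a) (fromℕ (a ℕ.^ k)) e ⟩
    fromℕ a * (fromℕ (a ℕ.^ k) * e)         ≤⟨ *-monoʳ-≤ (0≤fromℕ a) (expSum-power b m 0<s l k) ⟩
    fromℕ a * expSum s′ l′                  ≤⟨ expSum-logSum b m 0<s′ l′ ⟩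
    expSum (s′ + h) (c ℕ.+ l′)              ≡⟨ cong₂ expSum eq (sym (ℕ.+-assoc c (k ℕ.* c) l)) ⟩
    expSum (s + fromℕ (suc k) * h) (suc k ℕ.* c ℕ.+ l) ∎
    where
    a = suc b
    c = b ℕ.* suc m
    e = expSum s l
    h = logSum a m + 1/suc m
    s′ = s + fromℕ k * h
    l′ = k ℕ.* c ℕ.+ l
    0<s′ : 0ℚ < s′
    0<s′ = ℚ.+-mono-<-≤ 0<s
      (*-nonNeg {q = h} (0≤fromℕ k) (ℚ.+-mono-≤ (0≤logSum b m) (ℚ.<⇒≤ (0<1/suc m))))
    eq : s′ + h ≡ s + fromℕ (suc k) * h
    eq = trans (ℚ.+-assoc s (fromℕ k * h) h) (cong (λ q → s + q) (sym (fromℕ-suc-* k h)))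

  logSum-mono-≤ : ∀ b {m n} → m ℕ.≤ n → logSum (suc b) m ≤ logSum (suc b) n
  logSum-mono-≤ b m≤n = go (ℕ.≤⇒≤′ m≤n)
    where
    go : ∀ {m n} → m ℕ.≤′ n → logSum (suc b) m ≤ logSum (suc b) n
    go ℕ.≤′-refl = ℚ.≤-refl
    go (ℕ.≤′-step {n} p) = ℚ.≤-trans (go p) (logSum-incr b n)

  -- With N = aᵏ (n + 1), the sum for aᵏ⁺¹ splits at N into the sum for aᵏ and a sum for a of the
  -- finer mesh 1/N, and `logSum a` grows as the mesh shrinks.
  logSum-power : ∀ b n k → fromℕ k * logSum (suc b) n ≤ logSum (suc b ℕ.^ k) n
  logSum-power b n zero = ℚ.≤-reflexive (trans (ℚ.*-zeroˡ (logSum (suc b) n))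
    (sym (trans (cong (λ i → harmonic i - harmonic (suc n)) (ℕ.*-identityˡ (suc n)))
      (ℚ.+-inverseʳ (harmonic (suc n))))))
  logSum-power b n (suc k) = begin
    fromℕ (suc k) * logSum a n                 ≡⟨ fromℕ-suc-* k (logSum a n) ⟩
    fromℕ k * logSum a n + logSum a n          ≤⟨ ℚ.+-mono-≤ (logSum-power b n k) (logSum-mono-≤ b n≤n′) ⟩
    logSum (a ℕ.^ k) n + logSum a n′           ≡⟨ cong (λ i → logSum (a ℕ.^ k) n + (harmonic (a ℕ.* i) - harmonic i)) sn′ ⟩
    logSum (a ℕ.^ k) n + (harmonic (a ℕ.* N) - harmonic N)
      ≡⟨ telescope (harmonic N) (harmonic (suc n)) (harmonic (a ℕ.* N)) ⟩
    harmonic (a ℕ.* N) - harmonic (suc n)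
      ≡⟨ cong (λ i → harmonic i - harmonic (suc n)) (ℕ.*-assoc a (a ℕ.^ k) (suc n)) ⟨
    logSum (a ℕ.^ suc k) n ∎
    where
    a = suc b
    N = a ℕ.^ k ℕ.* suc n
    n′ = ℕ.pred N
    sn≤N : suc n ℕ.≤ N
    sn≤N = ℕ.m≤n*m (suc n) (a ℕ.^ k) {{ℕ.m^n≢0 a k}}
    sn′ : suc n′ ≡ N
    sn′ = ℕ.suc-pred N {{ℕ.>-nonZero (ℕ.≤-trans (ℕ.s≤s ℕ.z≤n) sn≤N)}}
    n≤n′ : n ℕ.≤ n′
    n≤n′ = ℕ.pred-mono-≤ sn≤N
    telescope : ∀ x y z → x - y + (z - x) ≡ z - y
    telescope = solve-∀ ℚ-ring

  0≤inv : ∀ {q} → 0ℚ < q → 0ℚ ≤ inv q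
  0≤inv {q} 0<q = ℚ.*-cancelˡ-≤-pos q {{positive 0<q}} (begin
    q * 0ℚ       ≡⟨ ℚ.*-zeroʳ q ⟩
    0ℚ           ≤⟨ ℚ.<⇒≤ (ℚ.positive⁻¹ 1ℚ) ⟩
    1ℚ           ≡⟨ inv-inverse q (λ q≡0 → ℚ.<⇒≢ 0<q (sym q≡0)) ⟨
    q * inv q    ∎)

  -- `f-large` is what `log (suc a) / log (2 ℕ.+ b) ⟨ log#0 b ⟩ <
  -- ε` unfolds to when `f` is the sequence of the real `ε`.
  module _ (a b : ℕ) {f : ℕ → ℚ} {e : ℚ} (0<e : 0ℚ < e)
    (f-large : Eventually λ n → logSum (suc a) n * inv (logSum (2 ℕ.+ b) n) + e ≤ f n) where

    N₀ = proj₁ f-large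

    0<logSum : ∀ n → 0ℚ < logSum (2 ℕ.+ b) n
    0<logSum n = ℚ.<-≤-trans (ℚ.positive⁻¹ ½) (½≤logSum b n)

    0≤f : ∀ n → N₀ ℕ.≤ n → 0ℚ ≤ f n
    0≤f n N₀≤n = ℚ.≤-trans
      (ℚ.+-mono-≤ (*-nonNeg (0≤logSum a n) (0≤inv (0<logSum n))) (ℚ.<⇒≤ 0<e)) (proj₂ f-large n N₀≤n)

    log-gap : ∃ λ d → 0ℚ < d × ∃ λ m → ∀ n → N₀ ℕ.+ m ℕ.≤ n →
      d + (logSum (suc a) m + 1/suc m) ≤ f n * logSum (2 ℕ.+ b) n
    log-gap = go (quotient four e (ℚ.positive⁻¹ four) 0<e)
      where
      -- Since `logSum (2 ℕ.+ b) n` is at least ½, the surplus `e` is worth at least e/2 = 2d after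
      -- multiplication: one `d` absorbs the error `1/suc m`, the other remains as the gain.
      four = 1ℚ + 1ℚ + 1ℚ + 1ℚ
      go : (∃ λ d → 0ℚ < d × four * d ≡ e) → ∃ λ d → 0ℚ < d × ∃ λ m → ∀ n → N₀ ℕ.+ m ℕ.≤ n →
        d + (logSum (suc a) m + 1/suc m) ≤ f n * logSum (2 ℕ.+ b) n
      go (d , 0<d , 4d≡e) = d , 0<d , m , bound
        where
        m = proj₁ (archimedean d 0<d)
        half : ∀ d → four * d * ½ ≡ d + d
        half = solve-∀ ℚ-ring
        regroup : ∀ d l → d + (l + d) ≡ l + (d + d)
        regroup = solve-∀ ℚ-ring
        distribute : ∀ l i e l′ → l * (l′ * i) + e * l′ ≡ (l * i + e) * l′
        distribute = solve-∀ ℚ-ring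
        bound : ∀ n → N₀ ℕ.+ m ℕ.≤ n → d + (logSum (suc a) m + 1/suc m) ≤ f n * logSum (2 ℕ.+ b) n
        bound n N≤n = begin
          d + (l + 1/suc m)       ≤⟨ ℚ.+-monoʳ-≤ d (ℚ.+-monoʳ-≤ l (ℚ.<⇒≤ (proj₂ (archimedean d 0<d) m ℕ.≤-refl))) ⟩
          d + (l + d)             ≡⟨ regroup d l ⟩
          l + (d + d)             ≡⟨ cong (λ q → l + q) (trans (sym (half d)) (cong (_* ½) 4d≡e)) ⟩
          l + e * ½               ≤⟨ ℚ.+-mono-≤ (logSum-mono-≤ a (ℕ.m+n≤o⇒n≤o N₀ N≤n))
                                                (*-monoʳ-≤ (ℚ.<⇒≤ 0<e) (½≤logSum b n)) ⟩
          lₙ + e * l′             ≡⟨ cong (_+ e * l′) (trans (cong (lₙ *_) (inv-inverse l′ l′≢0)) (ℚ.*-identityʳ lₙ)) ⟨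
          lₙ * (l′ * inv l′) + e * l′ ≡⟨ distribute lₙ (inv l′) e l′ ⟩
          (lₙ * inv l′ + e) * l′  ≤⟨ *-monoˡ-≤ (ℚ.<⇒≤ (0<logSum n)) (proj₂ f-large n (ℕ.m+n≤o⇒m≤o N₀ N≤n)) ⟩
          f n * l′                ∎
          where
          l = logSum (suc a) m
          lₙ = logSum (suc a) n
          l′ = logSum (2 ℕ.+ b) n
          l′≢0 = λ l′≡0 → ℚ.<⇒≢ (0<logSum n) (sym l′≡0)

    -- Of the exponent K (d + h), the part K h produces the factor (a + 1)ᵏ, and the part K d is
    -- kept for the linear partial sum 1 + K d. As `m` is chosen before `n`, the number `l` of terms
    -- depends on `k` alone and is exceeded by every late `n`.
    exp-growth : ∃ λ d → 0ℚ < d × (∀ k → Eventually λ n →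
      fromℕ (suc a ℕ.^ suc k) * (1ℚ + fromℕ (suc k) * d) ≤ expSum (f n * logSum ((2 ℕ.+ b) ℕ.^ suc k) n) n)
    exp-growth = go log-gap
      where
      go : (∃ λ d → 0ℚ < d × ∃ λ m → ∀ n → N₀ ℕ.+ m ℕ.≤ n →
        d + (logSum (suc a) m + 1/suc m) ≤ f n * logSum (2 ℕ.+ b) n) → ∃ λ d → 0ℚ < d × (∀ k → Eventually λ n →
        fromℕ (suc a ℕ.^ suc k) * (1ℚ + fromℕ (suc k) * d) ≤ expSum (f n * logSum ((2 ℕ.+ b) ℕ.^ suc k) n) n)
      go (d , 0<d , m , gap) = d , 0<d , λ k′ →
        let
          k = suc k′
          K = fromℕ k
          l = k ℕ.* (a ℕ.* suc m) ℕ.+ 1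
          h = logSum (suc a) m + 1/suc m
          s = K * d
          0<s = *-pos (0<fromℕ-suc k′) 0<d
          0<s+Kh : 0ℚ < s + K * h
          0<s+Kh = ℚ.+-mono-<-≤ 0<s (*-nonNeg {K} {h} (0≤fromℕ k) (ℚ.+-mono-≤ (0≤logSum a m) (ℚ.<⇒≤ (0<1/suc m))))
        in l ℕ.+ (N₀ ℕ.+ m) , λ n l+N≤n →
        let
          N≤n = ℕ.m+n≤o⇒n≤o l l+N≤n
          exponent : s + K * h ≤ f n * logSum ((2 ℕ.+ b) ℕ.^ k) n
          exponent = begin
            K * d + K * h                       ≡⟨ ℚ.*-distribˡ-+ K d h ⟨
            K * (d + h)                         ≤⟨ *-monoʳ-≤ (0≤fromℕ k) (gap n N≤n) ⟩
            K * (f n * logSum (2 ℕ.+ b) n)      ≡⟨ swap K (f n) (logSum (2 ℕ.+ b) n) ⟩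
            f n * (K * logSum (2 ℕ.+ b) n)      ≤⟨ *-monoʳ-≤ (0≤f n (ℕ.m+n≤o⇒m≤o N₀ N≤n)) (logSum-power (suc b) n k) ⟩
            f n * logSum ((2 ℕ.+ b) ℕ.^ k) n    ∎
        in begin
          fromℕ (suc a ℕ.^ k) * (1ℚ + s)       ≡⟨ cong (λ q → fromℕ (suc a ℕ.^ k) * q) (linear s) ⟩
          fromℕ (suc a ℕ.^ k) * expSum s 1     ≤⟨ expSum-power a m 0<s 1 k ⟩
          expSum (s + K * h) l                 ≤⟨ expSum-monoʳ-≤ 0<s+Kh (ℕ.m+n≤o⇒m≤o l l+N≤n) ⟩
          expSum (s + K * h) n                 ≤⟨ expSum-monoˡ-≤ 0<s+Kh exponent n ⟩
          expSum (f n * logSum ((2 ℕ.+ b) ℕ.^ k) n) n ∎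
        where
        swap : ∀ x y z → x * (y * z) ≡ y * (x * z)
        swap = solve-∀ ℚ-ring
        linear : ∀ s → 1ℚ + s ≡ 0ℚ + 1ℚ + 1ℚ * s * 1ℚ
        linear = solve-∀ ℚ-ring

  -- The summand 1 of the last factor yields c t ≥ c, and the other yields at least t because c d (k
  -- + 1) ≥ 1.
  exceeds : ∀ c d k t → 0ℚ < c → 1/suc k ≤ c * d → 1 ℕ.≤ t →
    fromℕ t + c ≤ c * (fromℕ t * (1ℚ + fromℕ (suc k) * d))
  exceeds c d k t 0<c r≤cd 1≤t = begin
    T + c                           ≡⟨ cong₂ _+_ (ℚ.*-identityʳ T) (ℚ.*-identityʳ c) ⟨
    T * 1ℚ + c * 1ℚ                 ≤⟨ ℚ.+-mono-≤ (*-monoʳ-≤ (0≤fromℕ t) 1≤Kcd) (*-monoʳ-≤ (ℚ.<⇒≤ 0<c) (fromℕ-mono-≤ 1≤t)) ⟩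
    T * (K * (c * d)) + c * T       ≡⟨ regroup T K c d ⟩
    c * (T * (1ℚ + K * d))          ∎
    where
    T = fromℕ t
    K = fromℕ (suc k)
    1≤Kcd : 1ℚ ≤ K * (c * d)
    1≤Kcd = subst (_≤ K * (c * d)) (fromℕ*1/suc k) (*-monoʳ-≤ (0≤fromℕ (suc k)) r≤cd)
    regroup : ∀ T K c d → T * (K * (c * d)) + c * T ≡ c * (T * (1ℚ + K * d))
    regroup = solve-∀ ℚ-ring

open ExponentialGrowth

-- The iterated Paley family of lines and the signs of its crossings.

module LineFamily where
  open import Data.Rational.Base using (_+_; _*_; _-_; -_; ∣_∣; _≤_; _<_)
  open ℚ.≤-Reasoning

  -- The line y = A x + B, z = C x + D.
  data Coefficient : Set where
    A B C D : Coefficient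

  Coefficients : Set
  Coefficients = Coefficient → ℚ

  _⊖_ : Coefficients → Coefficients → Coefficients
  (p ⊖ q) x = p x - q x

  -- With δ = p ⊖ q, the lines p and q cross above x = - δ B / δ A, where their
  -- heights differ by det δ / δ A.
  det : Coefficients → ℚ
  det δ = δ D * δ A - δ C * δ B

  infix 4 _▷_
  _▷_ : Rel Coefficients 0ℓ
  p ▷ q = 0ℚ < (p ⊖ q) A * det (p ⊖ q)

  -- The form has odd degree, so exchanging the two lines negates it.
  ▷-asym : ∀ p q → p ▷ q → ¬ q ▷ p
  ▷-asym p q p▷q q▷p = ℚ.<-asym p▷q (subst (_< 0ℚ) eq (ℚ.neg-antimono-< q▷p))
    where
    odd : ∀ a b c d a′ b′ c′ d′ →
      - ((a′ - a) * ((d′ - d) * (a′ - a) - (c′ - c) * (b′ - b))) ≡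
      (a - a′) * ((d - d′) * (a - a′) - (c - c′) * (b - b′))
    odd = solve-∀ ℚ-ring
    eq = odd (p A) (p B) (p C) (p D) (q A) (q B) (q C) (q D)

  -- The first factor being nonzero makes the projections cross; the second being nonzero keeps the
  -- points of the two lines apart.
  ▷-generic : ∀ p q → p ▷ q ⊎ q ▷ p → (p ⊖ q) A ≢ 0ℚ × det (p ⊖ q) ≢ 0ℚ
  ▷-generic p q (inj₁ p▷q) =
    (λ eq → ℚ.<⇒≢ p▷q (sym (trans (cong (_* det (p ⊖ q)) eq) (ℚ.*-zeroˡ (det (p ⊖ q)))))) ,
    (λ eq → ℚ.<⇒≢ p▷q (sym (trans (cong ((p ⊖ q) A *_) eq) (ℚ.*-zeroʳ ((p ⊖ q) A)))))
  ▷-generic p q (inj₂ q▷p) with ▷-generic q p (inj₁ q▷p)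
  ... | a≢0 , det≢0 =
    (λ eq → a≢0 (trans (flip (p A) (q A)) (cong -_ eq))) ,
    (λ eq → det≢0 (trans (even (p A) (p B) (p C) (p D) (q A) (q B) (q C) (q D)) eq))
    where
    flip : ∀ x y → y - x ≡ - (x - y)
    flip = solve-∀ ℚ-ring
    even : ∀ a b c d a′ b′ c′ d′ →
      (d′ - d) * (a′ - a) - (c′ - c) * (b′ - b) ≡ (d - d′) * (a - a′) - (c - c′) * (b - b′)
    even = solve-∀ ℚ-ring

  -- Seven lines realising the Paley tournament, found by computer search; the
  -- columns are A, B, C and D.
  coefficients : Fin 7 → Vec ℕ 4
  coefficients = lookup
    ( (5 ∷ 6 ∷ 2 ∷ 5 ∷ [])
    ∷ (3 ∷ 1 ∷ 7 ∷ 3 ∷ [])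
    ∷ (0 ∷ 3 ∷ 1 ∷ 4 ∷ [])
    ∷ (4 ∷ 0 ∷ 1 ∷ 3 ∷ [])
    ∷ (8 ∷ 3 ∷ 3 ∷ 2 ∷ [])
    ∷ (7 ∷ 0 ∷ 6 ∷ 2 ∷ [])
    ∷ (6 ∷ 8 ∷ 0 ∷ 2 ∷ [])
    ∷ [])

  index : Coefficient → Fin 4
  index A = zero
  index B = suc zero
  index C = suc (suc zero)
  index D = suc (suc (suc zero))

  vertex : Fin 7 → Coefficients
  vertex i x = fromℕ (lookup (coefficients i) (index x))

  vertex-bounded : ∀ i j x → ∣ (vertex i ⊖ vertex j) x ∣ ≤ fromℕ 8
  vertex-bounded i j x = go x i j
    where
    bounded? : ∀ x → Dec (∀ i j → ∣ (vertex i ⊖ vertex j) x ∣ ≤ fromℕ 8)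
    bounded? x = all? λ i → all? λ j → ∣ (vertex i ⊖ vertex j) x ∣ ℚ.≤? fromℕ 8
    go : ∀ x i j → ∣ (vertex i ⊖ vertex j) x ∣ ≤ fromℕ 8
    go A = from-yes (bounded? A)
    go B = from-yes (bounded? B)
    go C = from-yes (bounded? C)
    go D = from-yes (bounded? D)

  -- The entries are integers, so a nonzero value has absolute value at least 1. This margin is what
  -- a perturbation by `ε` has to stay within.
  vertex-sign : ∀ i j → Paley i j → let δ = vertex i ⊖ vertex j in
    (1ℚ ≤ δ A × 1ℚ ≤ det δ) ⊎ (δ A ≤ - 1ℚ × det δ ≤ - 1ℚ)
  vertex-sign = from-yes (all? λ i → all? λ j → let δ = vertex i ⊖ vertex j in paley? i j →-dec
    (((1ℚ ℚ.≤? δ A) ×-dec (1ℚ ℚ.≤? det δ)) ⊎-dec ((δ A ℚ.≤? - 1ℚ) ×-dec (det δ ℚ.≤? - 1ℚ))))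

  paley-total : ∀ i j → i ≢ j → Paley i j ⊎ Paley j i
  paley-total = from-yes (all? λ i → all? λ j → ¬? (i Fin.≟ j) →-dec (paley? i j ⊎-dec paley? j i))

  near⇒pos : ∀ {p q} → 1ℚ ≤ p → ∣ q - p ∣ < 1ℚ → 0ℚ < q
  near⇒pos {p} {q} 1≤p near = begin-strict
    0ℚ                   ≡⟨ ℚ.+-inverseʳ 1ℚ ⟨
    1ℚ - 1ℚ              <⟨ ℚ.+-monoʳ-< 1ℚ (ℚ.neg-antimono-< near) ⟩
    1ℚ - ∣ q - p ∣       ≤⟨ ℚ.+-monoˡ-≤ (- ∣ q - p ∣) 1≤p ⟩
    p - ∣ q - p ∣        ≡⟨ cong (λ r → p - r) (∣-∣-sym q p) ⟩
    p - ∣ p - q ∣        ≤⟨ ℚ.+-monoʳ-≤ p (ℚ.neg-antimono-≤ (≤∣∣ (p - q))) ⟩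
    p - (p - q)          ≡⟨ cancel p q ⟩
    q                    ∎
    where
    cancel : ∀ p q → p - (p - q) ≡ q
    cancel = solve-∀ ℚ-ring

  near⇒neg : ∀ {p q} → p ≤ - 1ℚ → ∣ q - p ∣ < 1ℚ → q < 0ℚ
  near⇒neg {p} {q} p≤-1 near = subst (_< 0ℚ) (neg-involutive q) (ℚ.neg-antimono-<
    (near⇒pos (ℚ.neg-antimono-≤ p≤-1)
      (subst (_< 1ℚ) (trans (sym (ℚ.∣-p∣≡∣p∣ (q - p))) (cong ∣_∣ (flip p q))) near)))
    where
    flip : ∀ p q → - (q - p) ≡ - q - - p
    flip = solve-∀ ℚ-ring

  -- Small enough for 9ε < 1 and 8 + 9ε ≤ 9 and, in det-near, 36 · 9ε < 1.
  ε : ℚ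
  ε = 1/suc 499

  infixl 6 _⊞_
  _⊞_ : Coefficients → Coefficients → Coefficients
  (p ⊞ q) x = p x + ε * q x

  det-near : ∀ K {p q} → 0ℚ ≤ K → (∀ x → ∣ p x ∣ ≤ K) → (∀ x → ∣ q x ∣ ≤ K) →
    ∀ r → (∀ x → ∣ p x - q x ∣ ≤ r) → ∣ det p - det q ∣ ≤ K * (r + r) + K * (r + r)
  det-near K {p} {q} 0≤K p≤ q≤ r p-q≤ = begin
    ∣ det p - det q ∣
      ≡⟨ cong ∣_∣ (regroup (p D * p A) (p C * p B) (q D * q A) (q C * q B)) ⟩
    ∣ (p D * p A - q D * q A) - (p C * p B - q C * q B) ∣
      ≤⟨ ℚ.∣p-q∣≤∣p∣+∣q∣ (p D * p A - q D * q A) (p C * p B - q C * q B) ⟩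
    ∣ p D * p A - q D * q A ∣ + ∣ p C * p B - q C * q B ∣
      ≤⟨ ℚ.+-mono-≤ (product D A) (product C B) ⟩
    K * (r + r) + K * (r + r) ∎
    where
    regroup : ∀ x y z w → x - y - (z - w) ≡ x - z - (y - w)
    regroup = solve-∀ ℚ-ring
    product : ∀ x y → ∣ p x * p y - q x * q y ∣ ≤ K * (r + r)
    product x y = ℚ.≤-trans (product-bound (p x) (p y) (q x) (q y) K 0≤K (p≤ x) (q≤ y))
      (*-monoʳ-≤ 0≤K (ℚ.+-mono-≤ (p-q≤ x) (p-q≤ y)))

  Bounded₉ : Coefficients → Set
  Bounded₉ δ = ∀ x → ∣ δ x ∣ ≤ fromℕ 9

  module _ {δ} (δ≤9 : Bounded₉ δ) where

    ⊞-near : ∀ v x → ∣ (v ⊞ δ) x - v x ∣ ≤ ε * fromℕ 9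
    ⊞-near v x = begin
      ∣ v x + ε * δ x - v x ∣   ≡⟨ cong ∣_∣ (ring3 (v x) (ε * δ x)) ⟩
      ∣ ε * δ x ∣               ≡⟨ ℚ.∣p*q∣≡∣p∣*∣q∣ ε (δ x) ⟩
      ε * ∣ δ x ∣               ≤⟨ *-monoʳ-≤ (ℚ.<⇒≤ (0<1/suc 499)) (δ≤9 x) ⟩
      ε * fromℕ 9               ∎

    -- The bound 9 reproduces itself, being at least 8 from the outer seven plus 9ε from the inner
    -- copy. Hence the same `ε` serves every level of the iteration.
    ⊞-bounded : ∀ i j → Bounded₉ ((vertex i ⊖ vertex j) ⊞ δ)
    ⊞-bounded i j x = begin
      ∣ (v ⊞ δ) x ∣                        ≡⟨ cong ∣_∣ (ring4 ((v ⊞ δ) x) (v x)) ⟩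
      ∣ v x + ((v ⊞ δ) x - v x) ∣          ≤⟨ ℚ.∣p+q∣≤∣p∣+∣q∣ (v x) ((v ⊞ δ) x - v x) ⟩
      ∣ v x ∣ + ∣ (v ⊞ δ) x - v x ∣        ≤⟨ ℚ.+-mono-≤ (vertex-bounded i j x) (⊞-near v x) ⟩
      fromℕ 8 + ε * fromℕ 9                ≤⟨ from-yes (fromℕ 8 + ε * fromℕ 9 ℚ.≤? fromℕ 9) ⟩
      fromℕ 9                              ∎
      where v = vertex i ⊖ vertex j

    ⊞-sign : ∀ i j → Paley i j → let δ′ = (vertex i ⊖ vertex j) ⊞ δ in 0ℚ < δ′ A * det δ′
    ⊞-sign i j i⇒j = sign (vertex-sign i j i⇒j)
      where
      v = vertex i ⊖ vertex j
      δ′ = v ⊞ δ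
      near-a : ∣ δ′ A - v A ∣ < 1ℚ
      near-a = ℚ.≤-<-trans (⊞-near v A) (from-yes (ε * fromℕ 9 ℚ.<? 1ℚ))
      near-det : ∣ det δ′ - det v ∣ < 1ℚ
      near-det = ℚ.≤-<-trans
        (det-near (fromℕ 9) {δ′} {v} (0≤fromℕ 9) (⊞-bounded i j)
          (λ x → ℚ.≤-trans (vertex-bounded i j x) (fromℕ-mono-≤ (ℕ.n≤1+n 8)))
          (ε * fromℕ 9) (⊞-near v))
        (from-yes (fromℕ 9 * (ε * fromℕ 9 + ε * fromℕ 9) + fromℕ 9 * (ε * fromℕ 9 + ε * fromℕ 9) ℚ.<? 1ℚ))
      sign : (1ℚ ≤ v A × 1ℚ ≤ det v) ⊎ (v A ≤ - 1ℚ × det v ≤ - 1ℚ) → 0ℚ < δ′ A * det δ′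
      sign (inj₁ (1≤a , 1≤det)) = *-pos {δ′ A} {det δ′} (near⇒pos {v A} {δ′ A} 1≤a near-a) (near⇒pos {det v} {det δ′} 1≤det near-det)
      sign (inj₂ (a≤-1 , det≤-1)) = ℚ.positive⁻¹ (δ′ A * det δ′) {{ℚ.neg*neg⇒pos
        (δ′ A) {{negative (near⇒neg {v A} {δ′ A} a≤-1 near-a)}} (det δ′) {{negative (near⇒neg {det v} {det δ′} det≤-1 near-det)}}}}

  ⊞-⊖ : ∀ p q p′ q′ x → ((p ⊞ q) ⊖ (p′ ⊞ q′)) x ≡ ((p ⊖ p′) ⊞ (q ⊖ q′)) x
  ⊞-⊖ p q p′ q′ x = regroup (p x) ε (q x) (p′ x) (q′ x)
    where
    regroup : ∀ p e q p′ q′ → p + e * q - (p′ + e * q′) ≡ p - p′ + e * (q - q′)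
    regroup = solve-∀ ℚ-ring

  sign-cong : ∀ {p q : Coefficients} → (∀ x → p x ≡ q x) → p A * det p ≡ q A * det q
  sign-cong p≗q = cong₂ _*_ (p≗q A) (cong₂ _-_ (cong₂ _*_ (p≗q D) (p≗q A)) (cong₂ _*_ (p≗q C) (p≗q B)))

  -- The common translation `p` cancels in the difference, and the cubic form picks up the positive
  -- factor ε³.
  ⊞-▷ : ∀ p {q q′} → q ▷ q′ → p ⊞ q ▷ p ⊞ q′
  ⊞-▷ p {q} {q′} q▷q′ = subst (0ℚ <_)
    (trans (scale ε (δ A) (δ B) (δ C) (δ D)) (sign-cong {λ x → ε * δ x} λ x → shift (p x) ε (q x) (q′ x)))
    (*-pos (*-pos (*-pos 0<ε 0<ε) 0<ε) q▷q′)
    where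
    δ = q ⊖ q′
    0<ε = 0<1/suc 499
    scale : ∀ e a b c d → e * e * e * (a * (d * a - c * b)) ≡
      e * a * ((e * d) * (e * a) - (e * c) * (e * b))
    scale = solve-∀ ℚ-ring
    shift : ∀ p e q q′ → e * (q - q′) ≡ p + e * q - (p + e * q′)
    shift = solve-∀ ℚ-ring

  family : ∀ k → Fin (7 ℕ.^ k) → Coefficients
  family zero    _ _ = 0ℚ
  family (suc k) i   =
    vertex (proj₁ (remQuot {7} (7 ℕ.^ k) i)) ⊞ family k (proj₂ (remQuot {7} (7 ℕ.^ k) i))

  family-bounded : ∀ k i j → Bounded₉ (family k i ⊖ family k j)
  family-bounded zero i j x = from-yes (∣ 0ℚ - 0ℚ ∣ ℚ.≤? fromℕ 9)
  family-bounded (suc k) i j x = subst (λ y → ∣ y ∣ ≤ fromℕ 9)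
    (sym (⊞-⊖ (vertex q) (family k i′) (vertex r) (family k j′) x))
    (⊞-bounded (family-bounded k i′ j′) q r x)
    where
    q = proj₁ (remQuot {7} (7 ℕ.^ k) i)
    r = proj₁ (remQuot {7} (7 ℕ.^ k) j)
    i′ = proj₂ (remQuot {7} (7 ℕ.^ k) i)
    j′ = proj₂ (remQuot {7} (7 ℕ.^ k) j)

  -- A record rather than a synonym, to keep the rational arithmetic folded.
  record Over (k : ℕ) (i j : Fin (7 ℕ.^ k)) : Set where
    constructor over
    field above : family k i ▷ family k j

  family-combine : ∀ k (q : Fin 7) i → family (suc k) (combine q i) ≡ vertex q ⊞ family k i
  family-combine k q i = cong (λ (q , i) → vertex q ⊞ family k i) (remQuot-combine q i)

  Over-outer : ∀ k q r i j → Paley q r → Over (suc k) (combine q i) (combine r j)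
  Over-outer k q r i j q⇒r = over (subst₂ _▷_ (sym (family-combine k q i)) (sym (family-combine k r j))
    (subst (0ℚ <_) (sign-cong {(vertex q ⊖ vertex r) ⊞ (family k i ⊖ family k j)} {(vertex q ⊞ family k i) ⊖ (vertex r ⊞ family k j)}
      λ x → sym (⊞-⊖ (vertex q) (family k i) (vertex r) (family k j) x))
      (⊞-sign (family-bounded k i j) q r q⇒r)))

  Over-inner : ∀ k q {i j} → Over k i j → Over (suc k) (combine q i) (combine q j)
  Over-inner k q {i} {j} (over i▷j) = over (subst₂ _▷_ (sym (family-combine k q i)) (sym (family-combine k q j))
    (⊞-▷ (vertex q) {family k i} {family k j} i▷j))

  -- Serves to show that the family is generic: a strict sign in one direction forces both factors
  -- of the form to be nonzero.
  Over-total : ∀ k i j → i ≢ j → Over k i j ⊎ Over k j i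
  Over-total zero zero zero i≢j = contradiction refl i≢j
  Over-total (suc k) i j i≢j = subst₂ (λ i j → Over (suc k) i j ⊎ Over (suc k) j i) i≡ j≡
    (blocks (proj₁ i′) (proj₁ j′) (proj₂ i′) (proj₂ j′) (proj₁ i′ Fin.≟ proj₁ j′)
      λ eq → i≢j (trans (sym i≡) (trans eq j≡)))
    where
    i′ = remQuot {7} (7 ℕ.^ k) i
    j′ = remQuot {7} (7 ℕ.^ k) j
    i≡ : combine (proj₁ i′) (proj₂ i′) ≡ i
    i≡ = combine-remQuot {7} (7 ℕ.^ k) i
    j≡ : combine (proj₁ j′) (proj₂ j′) ≡ j
    j≡ = combine-remQuot {7} (7 ℕ.^ k) j
    blocks : ∀ q r i j → Dec (q ≡ r) → combine q i ≢ combine r j →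
      Over (suc k) (combine q i) (combine r j) ⊎ Over (suc k) (combine r j) (combine q i)
    blocks q r i j (no q≢r) _ = Sum.map (Over-outer k q r i j) (Over-outer k r q j i) (paley-total q r q≢r)
    blocks q q i j (yes refl) i≢j = Sum.map (Over-inner k q) (Over-inner k q)
      (Over-total k i j λ i≡j → i≢j (cong (combine q) i≡j))

  Over-acyclic-≤ : ∀ k s → Acyclic (Over k) s → Subset.∣ s ∣ ℕ.≤ 3 ℕ.^ k
  Over-acyclic-≤ zero s _ = ∣p∣≤n s
  Over-acyclic-≤ (suc k) =
    acyclic-lexicographic {_⇒_ = Paley} {Over k} {Over (suc k)} (Over-outer k) (Over-inner k) paley-acyclic-≤3 (Over-acyclic-≤ k)

open LineFamily

-- Null sequences, and sequences bounded away from zero.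

module NullSequences where
  open import Data.Rational.Base using (_+_; _*_; _-_; -_; ∣_∣; _≤_; _<_)
  open ℚ.≤-Reasoning

  -- `x ≈ y` unfolds to `Null` of the difference of the two sequences, so a real equation can enter
  -- a polynomial identity between rationals index by index.
  Null : (ℕ → ℚ) → Set
  Null f = ∀ e → 0ℚ < e → Eventually λ n → ∣ f n ∣ < e

  null-cong : ∀ {f g} → (∀ n → f n ≡ g n) → Null f → Null g
  null-cong f≗g null e 0<e = let N , h = null e 0<e in N , λ n N≤n → subst (λ q → ∣ q ∣ < e) (f≗g n) (h n N≤n)

  null-zero : ∀ {f} → (∀ n → f n ≡ 0ℚ) → Null f
  null-zero f≗0 e 0<e = 0 , λ n _ → subst (λ q → ∣ q ∣ < e) (sym (f≗0 n)) 0<e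

  null-+ : ∀ {f g} → Null f → Null g → Null λ n → f n + g n
  null-+ {f} {g} f→0 g→0 e 0<e = go (quotient (1ℚ + 1ℚ) e (ℚ.positive⁻¹ (1ℚ + 1ℚ)) 0<e)
    where
    double : ∀ d → d + d ≡ (1ℚ + 1ℚ) * d
    double = solve-∀ ℚ-ring
    go : (∃ λ d → 0ℚ < d × (1ℚ + 1ℚ) * d ≡ e) → Eventually λ n → ∣ f n + g n ∣ < e
    go (d , 0<d , eq) = eventually-× (λ n f<d g<d → begin-strict
      ∣ f n + g n ∣        ≤⟨ ℚ.∣p+q∣≤∣p∣+∣q∣ (f n) (g n) ⟩
      ∣ f n ∣ + ∣ g n ∣    <⟨ ℚ.+-mono-< f<d g<d ⟩
      d + d                ≡⟨ trans (double d) eq ⟩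
      e                    ∎) (f→0 d 0<d) (g→0 d 0<d)

  null-bounded-* : ∀ {f g : ℕ → ℚ} K → 0ℚ < K → Eventually (λ n → ∣ f n ∣ ≤ K) → Null g → Null λ n → f n * g n
  null-bounded-* {f} {g} K 0<K f≤K g→0 e 0<e = go (quotient K e 0<K 0<e)
    where
    go : (∃ λ d → 0ℚ < d × K * d ≡ e) → Eventually λ n → ∣ f n * g n ∣ < e
    go (d , 0<d , eq) = eventually-× (λ n f≤K g<d → begin-strict
      ∣ f n * g n ∣        ≡⟨ ℚ.∣p*q∣≡∣p∣*∣q∣ (f n) (g n) ⟩
      ∣ f n ∣ * ∣ g n ∣    ≤⟨ *-monoˡ-≤ (ℚ.0≤∣p∣ (g n)) f≤K ⟩
      K * ∣ g n ∣          <⟨ ℚ.*-monoʳ-<-pos K {{positive 0<K}} g<d ⟩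
      K * d                ≡⟨ eq ⟩
      e                    ∎) f≤K (g→0 d 0<d)

  null-* : ∀ {f g} → Null f → Null g → Null λ n → f n * g n
  null-* {f} f→0 = null-bounded-* {f} 1ℚ 0<1 (let N , h = f→0 1ℚ 0<1 in N , λ n N≤n → ℚ.<⇒≤ (h n N≤n))
    where 0<1 = ℚ.positive⁻¹ 1ℚ

  null-scale : ∀ q {f} → Null f → Null λ n → q * f n
  null-scale q = null-bounded-* {λ _ → q} (∣ q ∣ + 1ℚ) (ℚ.+-mono-≤-< (ℚ.0≤∣p∣ q) (ℚ.positive⁻¹ 1ℚ))
    (0 , λ _ _ → p≤p+q ∣ q ∣ (ℚ.<⇒≤ (ℚ.positive⁻¹ 1ℚ)))

  null-- : ∀ {f g} → Null f → Null g → Null λ n → f n - g n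
  null-- {f} {g} f→0 g→0 = null-cong (λ n → eq (f n) (g n)) (null-+ f→0 (null-scale (- 1ℚ) g→0))
    where
    eq : ∀ x y → x + - 1ℚ * y ≡ x - y
    eq = solve-∀ ℚ-ring

  ≢0⇒∣∣>0 : ∀ {q} → q ≢ 0ℚ → 0ℚ < ∣ q ∣
  ≢0⇒∣∣>0 {q} q≢0 with ℚ.<-cmp 0ℚ ∣ q ∣
  ... | tri< 0<∣q∣ _ _ = 0<∣q∣
  ... | tri≈ _ 0≡∣q∣ _ = contradiction (ℚ.∣p∣≡0⇒p≡0 q (sym 0≡∣q∣)) q≢0
  ... | tri> _ _ ∣q∣<0 = contradiction (ℚ.<-≤-trans ∣q∣<0 (ℚ.0≤∣p∣ q)) (ℚ.<-irrefl refl)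

  ≢0⇒square>0 : ∀ {q} → q ≢ 0ℚ → 0ℚ < q * q
  ≢0⇒square>0 {q} q≢0 with ℚ.<-cmp q 0ℚ
  ... | tri< q<0 _ _ = ℚ.positive⁻¹ (q * q) {{ℚ.neg*neg⇒pos q {{negative q<0}} q {{negative q<0}}}}
  ... | tri≈ _ q≡0 _ = contradiction q≡0 q≢0
  ... | tri> _ _ 0<q = *-pos 0<q 0<q

  ∣p∣≤r⇒-r≤p : ∀ {p r} → ∣ p ∣ ≤ r → - r ≤ p
  ∣p∣≤r⇒-r≤p {p} {r} h = begin
    - r          ≤⟨ ℚ.neg-antimono-≤ (ℚ.≤-trans (ℚ.≤-reflexive (ℚ.∣-p∣≡∣p∣ p)) h) ⟩
    - ∣ - p ∣    ≤⟨ ℚ.neg-antimono-≤ (≤∣∣ (- p)) ⟩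
    - - p        ≡⟨ neg-involutive p ⟩
    p            ∎

  BoundedAway : (ℕ → ℚ) → Set
  BoundedAway f = ∃ λ e → 0ℚ < e × (Eventually (λ n → e ≤ f n) ⊎ Eventually (λ n → f n ≤ - e))

  -- Constructive substitute for deciding whether a real is zero. With d = 3e, one approximation
  -- within `e` is compared with 2e: above it, the sequence stays beyond `e` with a fixed sign;
  -- below it, the sequence stays within `d`.
  away⊎small : ∀ {f} → Cauchy f → ∀ {d} → 0ℚ < d → BoundedAway f ⊎ Eventually (λ n → ∣ f n ∣ ≤ d)
  away⊎small {f} cf {d} 0<d = go (quotient (1ℚ + 1ℚ + 1ℚ) d (ℚ.positive⁻¹ (1ℚ + 1ℚ + 1ℚ)) 0<d)
    where
    triple : ∀ e → e + e + e ≡ (1ℚ + 1ℚ + 1ℚ) * e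
    triple = solve-∀ ℚ-ring
    minus : ∀ e → - (e + e) + e ≡ - e
    minus = solve-∀ ℚ-ring
    plus : ∀ e → e + e - e ≡ e
    plus = solve-∀ ℚ-ring
    go : (∃ λ e → 0ℚ < e × (1ℚ + 1ℚ + 1ℚ) * e ≡ d) → BoundedAway f ⊎ Eventually (λ n → ∣ f n ∣ ≤ d)
    go (e , 0<e , 3e≡d) = split (ℚ.≤-total (e + e) ∣ f N ∣) (ℚ.∣p∣≡p∨∣p∣≡-p (f N))
      where
      N = proj₁ (cf e 0<e)
      close : ∀ n → N ℕ.≤ n → ∣ f n - f N ∣ ≤ e
      close n N≤n = ℚ.<⇒≤ (proj₂ (cf e 0<e) n N N≤n ℕ.≤-refl)
      split : e + e ≤ ∣ f N ∣ ⊎ ∣ f N ∣ ≤ e + e → ∣ f N ∣ ≡ f N ⊎ ∣ f N ∣ ≡ - f N →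
        BoundedAway f ⊎ Eventually (λ n → ∣ f n ∣ ≤ d)
      split (inj₁ 2e≤) (inj₁ eq) = inj₁ (e , 0<e , inj₁ (N , λ n N≤n → begin
        e                      ≡⟨ plus e ⟨
        e + e - e              ≤⟨ ℚ.+-mono-≤ 2e≤ (∣p∣≤r⇒-r≤p (close n N≤n)) ⟩
        ∣ f N ∣ + (f n - f N)  ≡⟨ cong (_+ (f n - f N)) eq ⟩
        f N + (f n - f N)      ≡⟨ ring4 (f n) (f N) ⟨
        f n                    ∎))
      split (inj₁ 2e≤) (inj₂ eq) = inj₁ (e , 0<e , inj₂ (N , λ n N≤n → begin
        f n                    ≡⟨ ring4 (f n) (f N) ⟩
        f N + (f n - f N)      ≡⟨ cong (_+ (f n - f N)) (trans (sym (neg-involutive (f N))) (cong -_ (sym eq))) ⟩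
        - ∣ f N ∣ + (f n - f N) ≤⟨ ℚ.+-mono-≤ (ℚ.neg-antimono-≤ 2e≤) (ℚ.≤-trans (≤∣∣ (f n - f N)) (close n N≤n)) ⟩
        - (e + e) + e          ≡⟨ minus e ⟩
        - e                    ∎))
      split (inj₂ ≤2e) _ = inj₂ (N , λ n N≤n → begin
        ∣ f n ∣                    ≡⟨ cong ∣_∣ (ring4 (f n) (f N)) ⟩
        ∣ f N + (f n - f N) ∣      ≤⟨ ℚ.∣p+q∣≤∣p∣+∣q∣ (f N) (f n - f N) ⟩
        ∣ f N ∣ + ∣ f n - f N ∣    ≤⟨ ℚ.+-mono-≤ ≤2e (close n N≤n) ⟩
        e + e + e                  ≡⟨ trans (triple e) 3e≡d ⟩
        d                          ∎)

  null-constant⇒away : ∀ {f q} → Null (λ n → f n - q) → q ≢ 0ℚ → BoundedAway f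
  null-constant⇒away {f} {q} null q≢0 = go (quotient (1ℚ + 1ℚ) ∣ q ∣ (ℚ.positive⁻¹ (1ℚ + 1ℚ)) (≢0⇒∣∣>0 q≢0))
    where
    plus : ∀ e → e ≡ (1ℚ + 1ℚ) * e - e
    plus = solve-∀ ℚ-ring
    minus : ∀ e → - ((1ℚ + 1ℚ) * e) + e ≡ - e
    minus = solve-∀ ℚ-ring
    go : (∃ λ e → 0ℚ < e × (1ℚ + 1ℚ) * e ≡ ∣ q ∣) → BoundedAway f
    go (e , 0<e , 2e≡∣q∣) = e , 0<e , sign (ℚ.∣p∣≡p∨∣p∣≡-p q)
      where
      N = proj₁ (null e 0<e)
      close : ∀ n → N ℕ.≤ n → ∣ f n - q ∣ ≤ e
      close n N≤n = ℚ.<⇒≤ (proj₂ (null e 0<e) n N≤n)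
      sign : ∣ q ∣ ≡ q ⊎ ∣ q ∣ ≡ - q → Eventually (λ n → e ≤ f n) ⊎ Eventually (λ n → f n ≤ - e)
      sign (inj₁ eq) = inj₁ (N , λ n N≤n → begin
        e                    ≡⟨ plus e ⟩
        (1ℚ + 1ℚ) * e - e    ≡⟨ cong (_- e) (trans 2e≡∣q∣ eq) ⟩
        q - e                ≤⟨ ℚ.+-monoʳ-≤ q (∣p∣≤r⇒-r≤p (close n N≤n)) ⟩
        q + (f n - q)        ≡⟨ ring4 (f n) q ⟨
        f n                  ∎)
      sign (inj₂ eq) = inj₂ (N , λ n N≤n → begin
        f n                  ≡⟨ ring4 (f n) q ⟩
        q + (f n - q)        ≤⟨ ℚ.+-monoʳ-≤ q (ℚ.≤-trans (≤∣∣ (f n - q)) (close n N≤n)) ⟩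
        q + e                ≡⟨ cong (_+ e) (trans (sym (neg-involutive q)) (cong -_ (trans (sym eq) (sym 2e≡∣q∣)))) ⟩
        - ((1ℚ + 1ℚ) * e) + e ≡⟨ minus e ⟩
        - e                  ∎)

  away-cong : ∀ {f g} → (∀ n → f n ≡ g n) → BoundedAway f → BoundedAway g
  away-cong f≗g (e , 0<e , inj₁ (N , h)) = e , 0<e , inj₁ (N , λ n N≤n → subst (e ≤_) (f≗g n) (h n N≤n))
  away-cong f≗g (e , 0<e , inj₂ (N , h)) = e , 0<e , inj₂ (N , λ n N≤n → subst (_≤ - e) (f≗g n) (h n N≤n))

  -- The differences on the left are those of the incidence equations, in the form
  -- to which p ∈ᴸ ℓ unfolds.
  crossing-identity : ∀ a b c d a′ b′ c′ d′ x y z t t′ z₁ z₂ →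
    (a - a′) * ((z + z₁ * 1ℚ - (d + t * c)) - (z + z₂ * 1ℚ - (d′ + t′ * c′))
        - c * (x + z₁ * 0ℚ - (0ℚ + t * 1ℚ)) + c′ * (x + z₂ * 0ℚ - (0ℚ + t′ * 1ℚ)))
      + (c - c′) * (a * (x + z₁ * 0ℚ - (0ℚ + t * 1ℚ)) - a′ * (x + z₂ * 0ℚ - (0ℚ + t′ * 1ℚ))
        - ((y + z₁ * 0ℚ - (b + t * a)) - (y + z₂ * 0ℚ - (b′ + t′ * a′))))
    ≡ (a - a′) * (z₁ - z₂) - ((d - d′) * (a - a′) - (c - c′) * (b - b′))
  crossing-identity = solve-∀ ℚ-ring

  -- Both terms on the right are, up to a common sign, the scalar triple product of the two
  -- directions with a vector between the lines, taken once from the base points and once from the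
  -- given points. It does not change along the lines, so only incidence errors remain on the left.
  skew-identity : ∀ a b c d a′ b′ c′ d′ x y z x′ y′ z′ t t′ →
    (c - c′) * ((y - (b + t * a)) - (y′ - (b′ + t′ * a′)))
      + (c′ * a - a′ * c) * ((x - (0ℚ + t * 1ℚ)) - (x′ - (0ℚ + t′ * 1ℚ)))
      - (a - a′) * ((z - (d + t * c)) - (z′ - (d′ + t′ * c′)))
    ≡ ((d - d′) * (a - a′) - (c - c′) * (b - b′))
      - ((a - a′) * (z - z′) - (c - c′) * (y - y′) - (c′ * a - a′ * c) * (x - x′))
  skew-identity = solve-∀ ℚ-ring

open NullSequences

open import Defs

-- The family as a configuration of lines in real space.

away⇒# : ∀ {x y} → BoundedAway (λ n → seq x n ℚ.- seq y n) → x # y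
away⇒# {x} {y} (e , 0<e , inj₁ (N , h)) = inj₂ (e , 0<e , N , λ n N≤n → begin
  seq y n ℚ.+ e                       ≤⟨ ℚ.+-monoʳ-≤ (seq y n) (h n N≤n) ⟩
  seq y n ℚ.+ (seq x n ℚ.- seq y n)   ≡⟨ ring4 (seq x n) (seq y n) ⟨
  seq x n                             ∎)
  where open ℚ.≤-Reasoning
away⇒# {x} {y} (e , 0<e , inj₂ (N , h)) = inj₁ (e , 0<e , N , λ n N≤n → begin
  seq x n ℚ.+ e                                ≡⟨ cong (ℚ._+ e) (ring4 (seq x n) (seq y n)) ⟩
  seq y n ℚ.+ (seq x n ℚ.- seq y n) ℚ.+ e      ≤⟨ ℚ.+-monoˡ-≤ e (ℚ.+-monoʳ-≤ (seq y n) (h n N≤n)) ⟩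
  seq y n ℚ.+ ℚ.- e ℚ.+ e                      ≡⟨ cancel (seq y n) e ⟩
  seq y n                                      ∎)
  where
  open ℚ.≤-Reasoning
  cancel : ∀ y e → y ℚ.+ ℚ.- e ℚ.+ e ≡ y
  cancel = solve-∀ ℚ-ring

≈const⇒#0 : ∀ {x q} → x ≈ fromℚ q → q ≢ 0ℚ → x # 0ℝ
≈const⇒#0 {x} x≈q q≢0 = away⇒# {x} {0ℝ}
  (away-cong (λ n → sym (ℚ.+-identityʳ (seq x n))) (null-constant⇒away x≈q q≢0))

≡const⇒#0 : ∀ {x q} → (∀ n → seq x n ≡ q) → q ≢ 0ℚ → x # 0ℝ
≡const⇒#0 {x} {q} x≡q = ≈const⇒#0 {x} (null-zero λ n →
  trans (cong (ℚ._- q) (x≡q n)) (ℚ.+-inverseʳ q))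

upward : ℝ³
upward = ⟨ 0ℝ , 0ℝ , fromℚ 1ℚ ⟩

upward#0 : upward #ᵥ 0ᵥ
upward#0 = inj₂ (inj₂ (≡const⇒#0 {fromℚ 1ℚ} (λ _ → refl) λ ()))

toLine : Coefficients → Line
toLine p = record
  { base        = ⟨ 0ℝ , fromℚ (p B) , fromℚ (p D) ⟩
  ; direction   = ⟨ fromℚ 1ℚ , fromℚ (p A) , fromℚ (p C) ⟩
  ; direction#0 = inj₁ (≡const⇒#0 {fromℚ 1ℚ} (λ _ → refl) λ ())
  }

-- By the incidence equations, δa (z₁ - z₂) tends to `det′`. Multiplying by δa once more puts the
-- positive square δa² in front of a height difference that is eventually at least `e`. The
-- conclusion concerns fixed rationals, so one late index suffices.
crosses⇒▷ : ∀ p q → (p ⊖ q) A ≢ 0ℚ → CrossesOver upward (toLine p) (toLine q) → p ▷ q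
crosses⇒▷ p q δa≢0
  (⟨ x , y , z ⟩ , z₁ , z₂ , _ , (t , X , Y , Z) , (t′ , X′ , Y′ , Z′) , (e , 0<e , gap)) =
  witness (eventually-× ▷-at (null-scale δa g→0 (δa ℚ.* δa ℚ.* e) 0<δa²e) gap)
  where
  δa = (p ⊖ q) A
  δc = (p ⊖ q) C
  det′ = det (p ⊖ q)
  0<δa²e = *-pos (≢0⇒square>0 δa≢0) 0<e
  g : ℕ → ℚ
  g n = δa ℚ.* (seq z₁ n ℚ.- seq z₂ n) ℚ.- det′
  g→0 : Null g
  g→0 = null-cong
    (λ n → crossing-identity (p A) (p B) (p C) (p D) (q A) (q B) (q C) (q D)
      (seq x n) (seq y n) (seq z n) (seq t n) (seq t′ n) (seq z₁ n) (seq z₂ n))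
    (null-+
      (null-scale δa (null-+ (null-- (null-- Z Z′) (null-scale (p C) X)) (null-scale (q C) X′)))
      (null-scale δc (null-- (null-- (null-scale (p A) X) (null-scale (q A) X′)) (null-- Y Y′))))
  expand : ∀ a z d → a ℚ.* d ≡ a ℚ.* a ℚ.* z ℚ.- a ℚ.* (a ℚ.* z ℚ.- d)
  expand = solve-∀ ℚ-ring
  ▷-at : ∀ n → ℚ.∣ δa ℚ.* g n ∣ ℚ.< δa ℚ.* δa ℚ.* e → seq z₂ n ℚ.+ e ℚ.≤ seq z₁ n → p ▷ q
  ▷-at n small z₂+e≤z₁ = begin-strict
    0ℚ                                                         ≡⟨ ℚ.+-inverseʳ (δa ℚ.* δa ℚ.* e) ⟨
    δa ℚ.* δa ℚ.* e ℚ.- δa ℚ.* δa ℚ.* e                        <⟨ ℚ.+-monoʳ-< (δa ℚ.* δa ℚ.* e) (ℚ.neg-antimono-<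
                                                                    (ℚ.≤-<-trans (≤∣∣ (δa ℚ.* g n)) small)) ⟩
    δa ℚ.* δa ℚ.* e ℚ.- δa ℚ.* g n                             ≤⟨ ℚ.+-monoˡ-≤ (ℚ.- (δa ℚ.* g n))
                                                                    (*-monoʳ-≤ (ℚ.<⇒≤ (≢0⇒square>0 δa≢0)) e≤) ⟩
    δa ℚ.* δa ℚ.* (seq z₁ n ℚ.- seq z₂ n) ℚ.- δa ℚ.* g n       ≡⟨ expand δa (seq z₁ n ℚ.- seq z₂ n) det′ ⟨
    δa ℚ.* det′                                                ∎
    where
    open ℚ.≤-Reasoning
    e≤ : e ℚ.≤ seq z₁ n ℚ.- seq z₂ n
    e≤ = subst (ℚ._≤ seq z₁ n ℚ.- seq z₂ n) (ring3 (seq z₂ n) e) (ℚ.+-monoˡ-≤ (ℚ.- seq z₂ n) z₂+e≤z₁)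

directions-independent : ∀ p q → (p ⊖ q) A ≢ 0ℚ → direction (toLine p) ∦ direction (toLine q)
directions-independent p q δa≢0 = inj₂ (inj₂ (≡const⇒#0 {fromℚ 1ℚ * fromℚ (q A) - fromℚ (p A) * fromℚ 1ℚ}
  (λ _ → eq (p A) (q A)) λ -δ≡0 → δa≢0 (ℚ.neg-injective -δ≡0)))
  where
  eq : ∀ a a′ → 1ℚ ℚ.* a′ ℚ.- a ℚ.* 1ℚ ≡ ℚ.- (a ℚ.- a′)
  eq = solve-∀ ℚ-ring

-- If all three coordinate differences were at most η = ∣ det′ ∣ / K in absolute value, the triple
-- product in `skew-identity` would be too small to equal `det′`.
points-apart : ∀ p q → det (p ⊖ q) ≢ 0ℚ → ∀ r s → r ∈ᴸ toLine p → s ∈ᴸ toLine q → r #ᵥ s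
points-apart p q det≢0 r@(⟨ x , y , z ⟩) s@(⟨ x′ , y′ , z′ ⟩) (t , X , Y , Z) (t′ , X′ , Y′ , Z′) =
  go (quotient K ℚ.∣ det′ ∣ 0<K (≢0⇒∣∣>0 det≢0))
  where
  δa = (p ⊖ q) A
  δc = (p ⊖ q) C
  κ = q C ℚ.* p A ℚ.- q A ℚ.* p C
  det′ = det (p ⊖ q)
  -- The final 1 pays for the vanishing error `g`, and it makes `K` positive.
  K = ℚ.∣ δa ∣ ℚ.+ ℚ.∣ δc ∣ ℚ.+ ℚ.∣ κ ∣ ℚ.+ 1ℚ
  0<K : 0ℚ ℚ.< K
  0<K = ℚ.+-mono-≤-< (ℚ.+-mono-≤ (ℚ.+-mono-≤ (ℚ.0≤∣p∣ δa) (ℚ.0≤∣p∣ δc)) (ℚ.0≤∣p∣ κ)) (ℚ.positive⁻¹ 1ℚ)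
  u v w g : ℕ → ℚ
  u n = seq x n ℚ.- seq x′ n
  v n = seq y n ℚ.- seq y′ n
  w n = seq z n ℚ.- seq z′ n
  g n = det′ ℚ.- (δa ℚ.* w n ℚ.- δc ℚ.* v n ℚ.- κ ℚ.* u n)
  g→0 : Null g
  g→0 = null-cong
    (λ n → skew-identity (p A) (p B) (p C) (p D) (q A) (q B) (q C) (q D)
      (seq x n) (seq y n) (seq z n) (seq x′ n) (seq y′ n) (seq z′ n) (seq t n) (seq t′ n))
    (null-- (null-+ (null-scale δc (null-- Y Y′)) (null-scale κ (null-- X X′))) (null-scale δa (null-- Z Z′)))
  go : (∃ λ η → 0ℚ ℚ.< η × K ℚ.* η ≡ ℚ.∣ det′ ∣) → r #ᵥ s
  go (η , 0<η , Kη≡) = split (away⊎small (cauchy (x - x′)) 0<η)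
    (away⊎small (cauchy (y - y′)) 0<η) (away⊎small (cauchy (z - z′)) 0<η)
    where
    contradictory : ∀ n → (ℚ.∣ u n ∣ ℚ.≤ η × ℚ.∣ v n ∣ ℚ.≤ η) → (ℚ.∣ w n ∣ ℚ.≤ η × ℚ.∣ g n ∣ ℚ.< η) → r #ᵥ s
    contradictory n (u≤ , v≤) (w≤ , g<) = contradiction (begin-strict
      ℚ.∣ det′ ∣
        ≡⟨ cong ℚ.∣_∣ (ring4 det′ (δa ℚ.* w n ℚ.- δc ℚ.* v n ℚ.- κ ℚ.* u n)) ⟩
      ℚ.∣ δa ℚ.* w n ℚ.- δc ℚ.* v n ℚ.- κ ℚ.* u n ℚ.+ g n ∣
        ≤⟨ ℚ.∣p+q∣≤∣p∣+∣q∣ (δa ℚ.* w n ℚ.- δc ℚ.* v n ℚ.- κ ℚ.* u n) (g n) ⟩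
      ℚ.∣ δa ℚ.* w n ℚ.- δc ℚ.* v n ℚ.- κ ℚ.* u n ∣ ℚ.+ ℚ.∣ g n ∣
        ≤⟨ ℚ.+-monoˡ-≤ ℚ.∣ g n ∣ (ℚ.≤-trans (ℚ.∣p-q∣≤∣p∣+∣q∣ (δa ℚ.* w n ℚ.- δc ℚ.* v n) (κ ℚ.* u n))
             (ℚ.+-mono-≤ (ℚ.≤-trans (ℚ.∣p-q∣≤∣p∣+∣q∣ (δa ℚ.* w n) (δc ℚ.* v n))
               (ℚ.+-mono-≤ (scaled δa w≤) (scaled δc v≤))) (scaled κ u≤))) ⟩
      ℚ.∣ δa ∣ ℚ.* η ℚ.+ ℚ.∣ δc ∣ ℚ.* η ℚ.+ ℚ.∣ κ ∣ ℚ.* η ℚ.+ ℚ.∣ g n ∣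
        <⟨ ℚ.+-monoʳ-< (ℚ.∣ δa ∣ ℚ.* η ℚ.+ ℚ.∣ δc ∣ ℚ.* η ℚ.+ ℚ.∣ κ ∣ ℚ.* η) g< ⟩
      ℚ.∣ δa ∣ ℚ.* η ℚ.+ ℚ.∣ δc ∣ ℚ.* η ℚ.+ ℚ.∣ κ ∣ ℚ.* η ℚ.+ η
        ≡⟨ collect ℚ.∣ δa ∣ ℚ.∣ δc ∣ ℚ.∣ κ ∣ η ⟩
      K ℚ.* η
        ≡⟨ Kη≡ ⟩
      ℚ.∣ det′ ∣ ∎) (ℚ.<-irrefl refl)
      where
      open ℚ.≤-Reasoning
      scaled : ∀ k {f} → ℚ.∣ f ∣ ℚ.≤ η → ℚ.∣ k ℚ.* f ∣ ℚ.≤ ℚ.∣ k ∣ ℚ.* η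
      scaled k {f} f≤ = subst (ℚ._≤ ℚ.∣ k ∣ ℚ.* η) (sym (ℚ.∣p*q∣≡∣p∣*∣q∣ k f)) (*-monoʳ-≤ (ℚ.0≤∣p∣ k) f≤)
      collect : ∀ x y z e → x ℚ.* e ℚ.+ y ℚ.* e ℚ.+ z ℚ.* e ℚ.+ e ≡ (x ℚ.+ y ℚ.+ z ℚ.+ 1ℚ) ℚ.* e
      collect = solve-∀ ℚ-ring
    split : BoundedAway u ⊎ Eventually (λ n → ℚ.∣ u n ∣ ℚ.≤ η) →
      BoundedAway v ⊎ Eventually (λ n → ℚ.∣ v n ∣ ℚ.≤ η) →
      BoundedAway w ⊎ Eventually (λ n → ℚ.∣ w n ∣ ℚ.≤ η) → r #ᵥ s
    split (inj₁ away) _ _ = inj₁ (away⇒# {x} {x′} away)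
    split _ (inj₁ away) _ = inj₂ (inj₁ (away⇒# {y} {y′} away))
    split _ _ (inj₁ away) = inj₂ (inj₂ (away⇒# {z} {z′} away))
    split (inj₂ u≤) (inj₂ v≤) (inj₂ w≤) = witness (eventually-× contradictory
      (eventually-× (λ _ → _,_) u≤ v≤) (eventually-× (λ _ → _,_) w≤ (g→0 η 0<η)))

direction∦upward : ∀ p → direction (toLine p) ∦ upward
direction∦upward p = inj₂ (inj₁ (≡const⇒#0 {fromℚ (p C) * 0ℝ - fromℚ 1ℚ * fromℚ 1ℚ} (λ _ → eq (p C)) λ ()))
  where
  eq : ∀ c → c ℚ.* 0ℚ ℚ.- 1ℚ ℚ.* 1ℚ ≡ ℚ.- 1ℚ
  eq = solve-∀ ℚ-ring

projections-independent : ∀ p q → (p ⊖ q) A ≢ 0ℚ → ∀ u w →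
  IsProjection upward (direction (toLine p)) u → IsProjection upward (direction (toLine q)) w → u ∦ w
projections-independent p q δa≢0 ⟨ x , y , _ ⟩ ⟨ x′ , y′ , _ ⟩ (_ , t , X , Y , _) (_ , t′ , X′ , Y′ , _) =
  inj₂ (inj₂ (≈const⇒#0 {x * y′ - y * x′} (null-cong
    (λ n → identity (p A) (q A) (seq x n) (seq y n) (seq t n) (seq x′ n) (seq y′ n) (seq t′ n))
    (null-- (null-+ (null-+ Y′ (null-scale (q A) X)) (null-* X Y′))
      (null-+ (null-+ Y (null-scale (p A) X′)) (null-* Y X′))))
    λ eq → δa≢0 (ℚ.neg-injective (trans (flip (p A) (q A)) eq))))
  where
  flip : ∀ a a′ → ℚ.- (a ℚ.- a′) ≡ a′ ℚ.- a
  flip = solve-∀ ℚ-ring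
  -- With X and Y′ the errors of x against 1 and of y′ against a′, one has x y′ - a′ = Y′ + a′ X + X
  -- Y′, and symmetrically for y x′. The terms t · 0 are the horizontal part of a multiple of
  -- `upward`.
  identity : ∀ a a′ x y t x′ y′ t′ →
    (y′ ℚ.+ t′ ℚ.* 0ℚ ℚ.- a′) ℚ.+ a′ ℚ.* (x ℚ.+ t ℚ.* 0ℚ ℚ.- 1ℚ)
      ℚ.+ (x ℚ.+ t ℚ.* 0ℚ ℚ.- 1ℚ) ℚ.* (y′ ℚ.+ t′ ℚ.* 0ℚ ℚ.- a′)
    ℚ.- ((y ℚ.+ t ℚ.* 0ℚ ℚ.- a) ℚ.+ a ℚ.* (x′ ℚ.+ t′ ℚ.* 0ℚ ℚ.- 1ℚ)
      ℚ.+ (y ℚ.+ t ℚ.* 0ℚ ℚ.- a) ℚ.* (x′ ℚ.+ t′ ℚ.* 0ℚ ℚ.- 1ℚ))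
    ≡ x ℚ.* y′ ℚ.- y ℚ.* x′ ℚ.- (a′ ℚ.- a)
  identity = solve-∀ ℚ-ring

generic : ∀ k i j → i ≢ j → (family k i ⊖ family k j) A ≢ 0ℚ × det (family k i ⊖ family k j) ≢ 0ℚ
generic k i j i≢j with Over-total k i j i≢j
... | inj₁ (over i▷j) = ▷-generic (family k i) (family k j) (inj₁ i▷j)
... | inj₂ (over j▷i) = ▷-generic (family k i) (family k j) (inj₂ j▷i)

configuration : ∀ k → Configuration upward (7 ℕ.^ k)
configuration k = record
  { line = λ i → toLine (family k i)
  ; skew = λ i j i≢j →
      directions-independent (family k i) (family k j) (proj₁ (generic k i j i≢j)) ,
      points-apart (family k i) (family k j) (proj₂ (generic k i j i≢j))
  ; notParallel = λ i → direction∦upward (family k i)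
  ; projectionsNotParallel = λ i j i≢j →
      projections-independent (family k i) (family k j) (proj₁ (generic k i j i≢j))
  }

-- From stacked sets to the bound on the exponent.

Over-asym : ∀ k i j → Over k i j → ¬ Over k j i
Over-asym k i j (over i▷j) (over j▷i) = ▷-asym (family k i) (family k j) i▷j j▷i

-- On a stacked set the sign determines the crossing as well: by trichotomy one of two distinct
-- lines crosses over the other, and the wrong order would contradict asymmetry of the sign. A
-- directed triangle of signs is then refuted by transitivity of the crossings.
stacked⇒acyclic : ∀ k {s} → Stacked (configuration k) s → Acyclic (Over k) s
stacked⇒acyclic k {s} stacked i j l i∈s j∈s l∈s i▷j j▷l l▷i =
  Over-asym k i l (crosses i∈s l∈s (IsStrictTotalOrder.trans stacked {i , i∈s} {j , j∈s} {l , l∈s} (above i∈s j∈s i▷j) (above j∈s l∈s j▷l))) l▷i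
  where
  crosses : ∀ {i j} → i Subset.∈ s → j Subset.∈ s →
    CrossesOver upward (toLine (family k i)) (toLine (family k j)) → Over k i j
  crosses {i} {j} i∈s j∈s i>j = over (crosses⇒▷ (family k i) (family k j) (proj₁ (generic k i j i≢j)) i>j)
    where
    i≢j : i ≢ j
    i≢j i≡j = IsStrictTotalOrder.irrefl stacked {i , i∈s} {j , j∈s} i≡j i>j
  above : ∀ {i j} (i∈s : i Subset.∈ s) (j∈s : j Subset.∈ s) → Over k i j →
    CrossesOver upward (toLine (family k i)) (toLine (family k j))
  above {i} {j} i∈s j∈s i▷j with IsStrictTotalOrder.compare stacked (i , i∈s) (j , j∈s)
  ... | tri< i>j _ _ = i>j
  ... | tri≈ _ refl _ = contradiction i▷j (Over-asym k i i i▷j)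
  ... | tri> _ _ j>i = contradiction (crosses j∈s i∈s j>i) (Over-asym k i j i▷j)

proposition3 : sup[ Admissible ]≤ (log 3 / log 7 ⟨ log#0 5 ⟩)
proposition3 ε (_ , γ , (c , 0<c , N , c≤γ) , stacked-subset) (e , 0<e , large) =
  -- The bases are 3 = suc 2 and 7 = 2 + 5.
  go (exp-growth 2 5 {seq ε} 0<e large)
  where
  go : (∃ λ d → 0ℚ ℚ.< d × (∀ k → Eventually λ n →
    fromℕ (3 ℕ.^ suc k) ℚ.* (1ℚ ℚ.+ fromℕ (suc k) ℚ.* d) ℚ.≤
    expSum (seq ε n ℚ.* logSum (7 ℕ.^ suc k) n) n)) → _
  go (d , 0<d , growth) = too-large (stacked-subset (7 ℕ.^ k) {{ℕ.m^n≢0 7 k}} upward upward#0 (configuration k))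
    where
    -- This makes c d k ≥ 1, so that the linear gain 1 + k d outweighs the constant `c`.
    k′ = proj₁ (1/suc-below (c ℚ.* d) (*-pos 0<c 0<d))
    k = suc k′
    too-large : ¬ ∃ λ s → Stacked (configuration k) s ×
      γ * _^_ (7 ℕ.^ k) {{ℕ.m^n≢0 7 k}} ε ≤ fromℚ (fromℕ Subset.∣ s ∣)
    -- `_≤_` is the negation of `_<_`, so a uniform gap at all late indices has to be exhibited; the
    -- rational lower bound `c` of `γ` itself serves as the gap.
    too-large (s , stacked , bound) = bound (c , 0<c , eventually-× (λ n c≤γₙ growthₙ → begin
      fromℕ Subset.∣ s ∣ ℚ.+ c
        ≤⟨ ℚ.+-monoˡ-≤ c (fromℕ-mono-≤ (Over-acyclic-≤ k s (stacked⇒acyclic k stacked))) ⟩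
      fromℕ (3 ℕ.^ k) ℚ.+ c
        ≤⟨ exceeds c d k′ (3 ℕ.^ k) 0<c (proj₂ (1/suc-below (c ℚ.* d) (*-pos 0<c 0<d))) (ℕ.m^n>0 3 k) ⟩
      c ℚ.* (fromℕ (3 ℕ.^ k) ℚ.* (1ℚ ℚ.+ fromℕ k ℚ.* d))
        ≤⟨ *-monoʳ-≤ (ℚ.<⇒≤ 0<c) growthₙ ⟩
      c ℚ.* E n
        ≤⟨ *-monoˡ-≤ (0≤E n growthₙ) (subst (ℚ._≤ seq γ n) (ℚ.+-identityˡ c) c≤γₙ) ⟩
      seq γ n ℚ.* E n ∎) (N , c≤γ) (growth k′))
      where
      open ℚ.≤-Reasoning
      E : ℕ → ℚ
      E n = expSum (seq ε n ℚ.* logSum (7 ℕ.^ k) n) n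
      0≤E : ∀ n → fromℕ (3 ℕ.^ k) ℚ.* (1ℚ ℚ.+ fromℕ k ℚ.* d) ℚ.≤ E n → 0ℚ ℚ.≤ E n
      0≤E n = ℚ.≤-trans (*-nonNeg (0≤fromℕ (3 ℕ.^ k))
        (ℚ.+-mono-≤ (ℚ.<⇒≤ (ℚ.positive⁻¹ 1ℚ)) (ℚ.<⇒≤ (*-pos (0<fromℕ-suc k′) 0<d))))
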